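{- $c(4)=4/3$ and $c(8)=332/315$.
   Context: For $n\ge\ell\ge3$, $C(n,\ell)$ is the maximum number of directed cycles of length $\ell$ in an $n$-vertex tournament, $R(n,\ell)=\frac{(\ell-1)!}{2^\ell}\binom n\ell$ is the expected number of such cycles in the uniformly random $n$-vertex tournament, and $c(\ell)=\lim_{n\to\infty}C(n,\ell)/R(n,\ell)$. -}

module Defs where

open import Data.Bool using (Bool; true; false; not; _∧_; if_then_else_)
open import Data.Nat using (ℕ; zero; suc; _≤_; _∸_; _^_; NonZero; _!)
import Data.Nat as ℕ
open import Data.Nat.DivMod using () renaming (_/_ to _div_)
open import Data.Nat.Properties using (m^n≢0)
open import Data.Nat.Combinatorics using (_C_)
open import Data.Fin using (Fin; _≟_)
open import Data.List using (List; []; _∷_; [_]; map; concatMap; allFin; length; filter)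
open import Data.Bool.ListAction using (any)
open import Data.Maybe using (Maybe; just; nothing)
open import Data.Integer using (+_)
open import Data.Rational using (ℚ; _<_; _*_; _-_; ∣_∣; 0ℚ)
import Data.Rational as ℚ
open import Data.Product using (Σ; ∃; _×_)
open import Relation.Nullary using (¬_)
open import Relation.Nullary.Decidable using (⌊_⌋)
open import Relation.Binary.PropositionalEquality using (_≡_)

record Tournament (n : ℕ) : Set where
  field
    arc    : Fin n → Fin n → Bool
    irrefl : ∀ i → arc i i ≡ false
    total  : ∀ i j → ¬ (i ≡ j) → arc i j ≡ not (arc j i)
open Tournament public

allSeqs : (n ℓ : ℕ) → List (List (Fin n))
allSeqs n zero    = [ [] ]
allSeqs n (suc ℓ) = concatMap (λ xs → map (λ x → x ∷ xs) (allFin n)) (allSeqs n ℓ)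

distinct : ∀ {n} → List (Fin n) → Bool
distinct []       = true
distinct (x ∷ xs) = not (any (λ y → ⌊ x ≟ y ⌋) xs) ∧ distinct xs

chain : ∀ {n} → Tournament n → List (Fin n) → Bool
chain T (x ∷ y ∷ xs) = arc T x y ∧ chain T (y ∷ xs)
chain T _            = true

lastArc : ∀ {n} → Tournament n → Fin n → List (Fin n) → Bool
lastArc T x₀ []           = true
lastArc T x₀ (x ∷ [])     = arc T x x₀
lastArc T x₀ (x ∷ y ∷ xs) = lastArc T x₀ (y ∷ xs)

closed : ∀ {n} → Tournament n → List (Fin n) → Bool
closed T []       = true
closed T (x ∷ xs) = chain T (x ∷ xs) ∧ lastArc T x (x ∷ xs)

isCycleSeq : ∀ {n} → Tournament n → List (Fin n) → Bool
isCycleSeq T xs = distinct xs ∧ closed T xs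

cycleSeqs : ∀ {n} → Tournament n → ℕ → ℕ
cycleSeqs {n} T ℓ = length (filter (λ xs → isCycleSeq T xs Data.Bool.≟ true) (allSeqs n ℓ))
  where import Data.Bool

-- number of directed cycles of length ℓ (as subgraphs): each cycle
-- corresponds to exactly ℓ cyclic sequences (its ℓ rotations)
numCycles : ∀ {n} → Tournament n → (ℓ : ℕ) → .{{NonZero ℓ}} → ℕ
numCycles T ℓ = cycleSeqs T ℓ div ℓ

IsMaxCycles : (n ℓ : ℕ) → .{{NonZero ℓ}} → ℕ → Set
IsMaxCycles n ℓ m = (Σ (Tournament n) λ T → numCycles T ℓ ≡ m) × (∀ (T : Tournament n) → numCycles T ℓ ≤ m)

R : ℕ → ℕ → ℚ
R n ℓ = (+ (((ℓ ∸ 1) !) ℕ.* (n C ℓ))) ℚ./ (2 ^ ℓ)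
  where instance _ = m^n≢0 2 ℓ

-- c(ℓ) = c: for the function C(·,ℓ), C(n,ℓ)/R(n,ℓ) → c as n → ∞
-- (stated without division: |C(n,ℓ) - c·R(n,ℓ)| < ε·R(n,ℓ), R(n,ℓ) > 0 for n ≥ ℓ)
LimitIs : (ℓ : ℕ) → .{{NonZero ℓ}} → ℚ → Set
LimitIs ℓ c =
  ∀ (C : ℕ → ℕ) → (∀ n → ℓ ≤ n → IsMaxCycles n ℓ (C n)) →
  ∀ (ε : ℚ) → 0ℚ < ε →
  ∃ λ (N : ℕ) → ∀ n → N ≤ n →
    ∣ (+ (C n)) ℚ./ 1 - c * R n ℓ ∣ < ε * R n ℓ

{-# OPTIONS --safe #-}
-- Let K be the skew ±1 matrix of the tournament, J the all-ones matrix and u the all-ones vector, so that J + K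
-- is twice the adjacency matrix off the diagonal. Up to O(nˡ⁻¹), 2ˡ times the number of cyclic sequences of
-- length l is therefore tr (J + K)ˡ. The terms of its expansion that contain J are products of moments ⟨u, Kᵃu⟩;
-- for l = 4 and l = 8 they add up to nˡ minus a nonnegative combination of squared norms, and to nearly nˡ if Ku
-- is small. The remaining term tr Kˡ is a sum over l-tuples (v, x₁, …, xₗ₋₁), which we average over the
-- orderings of the xᵢ. Switching vertices so that they all point to v turns the sum over the orderings into
-- minus the signed number of Hamiltonian paths of a tournament on l − 1 vertices. The least values of this
-- number for 3 and 7 vertices are those of the transitive tournament, the signed tangent numbers −2 and −272,
-- whence c(4) = 1 + 2/3! and c(8) = 1 + 272/7!. They are attained asymptotically by the transitive tournament
-- switched at every other vertex: its degrees are balanced, and switching it further at the out-neighbours of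
-- any v gives a transitive tournament again.
-- The two minima are computed. Every tournament has a Hamiltonian path x₁ → … → xₘ, and for given xᵢ the signed
-- number is a multilinear polynomial in the signs of the arcs between non-consecutive xᵢ, 15 of them for m = 7,
-- which is minimised by branching on these signs.

module Submission where

open import Defs
open import Data.Bool as Bool using (Bool; true; false; not; _∧_; _∨_; _xor_; if_then_else_)
open import Data.Bool.ListAction using (any)
open import Data.Bool.Properties using (not-involutive; T-≡; ∧-assoc; ¬-not; not-¬; xor-same; xor-identityʳ)
open import Data.Bool.Solver using (module xor-∧-Solver)
open import Data.Fin as Fin using (Fin; zero; suc; toℕ)
import Data.Fin.Properties as Fin
open import Data.Integer as ℤ using (ℤ; +_; -[1+_]; -_; _+_; _*_; _-_; _≤_; _^_; ∣_∣; _⊓_; 0ℤ; 1ℤ)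
import Data.Integer.Properties as ℤ
open import Data.Integer.Solver using (module +-*-Solver)
open import Data.Integer.Tactic.RingSolver using (solve-∀)
open import Data.List using
  (List; []; _∷_; [_]; length; map; _++_; concatMap; allFin; filter; lookup; cartesianProduct)
open import Data.List.Membership.Propositional using (_∈_)
open import Data.List.Membership.Propositional.Properties using
  (∈-filter⁺; ∈-cartesianProduct⁺; ∈-allFin; ∈-lookup)
import Data.List.Properties as List
open import Data.List.Relation.Binary.Permutation.Propositional as ↭ using
  (_↭_; ↭-refl; ↭-sym; ↭-trans; ↭-prep; ↭-swap)
import Data.List.Relation.Binary.Permutation.Propositional.Properties as ↭
import Data.List.Relation.Binary.Permutation.Setoid.Properties as ↭ₛ
open import Data.List.Relation.Unary.All as All using (All; []; _∷_)
import Data.List.Relation.Unary.All.Properties as All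
open import Data.List.Relation.Unary.AllPairs as AllPairs using (AllPairs; []; _∷_)
open import Data.List.Relation.Unary.Any using (here; there)
open import Data.List.Relation.Unary.Linked using (Linked; []; [-]; _∷_)
open import Data.List.Relation.Unary.Linked.Properties using (Linked⇒AllPairs; AllPairs⇒Linked)
open import Data.List.Relation.Unary.Unique.Propositional using (Unique)
import Data.List.Relation.Unary.Unique.Propositional.Properties as Unique
open import Data.Nat as ℕ using (ℕ; zero; suc; _!)
open import Data.Nat.Combinatorics as Combinatorics using (nCk≡nPk/k!)
open import Data.Nat.Combinatorics.Base using (_P′_)
open import Data.Nat.Combinatorics.Specification using (k!∣nP′k)
import Data.Nat.DivMod as ℕ
import Data.Nat.Properties as ℕ
import Data.Nat.Tactic.RingSolver as ℕ-Ring
open import Data.Product using (_×_; _,_; proj₁; proj₂; ∃; uncurry)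
open import Data.Product.Properties using (≡-dec)
open import Data.Rational as ℚ using (ℚ; mkℚ; 0ℚ; toℚᵘ; _/_)
import Data.Rational.Properties as ℚ
open import Data.Rational.Unnormalised as ℚᵘ using (ℚᵘ; mkℚᵘ)
import Data.Rational.Unnormalised.Properties as ℚᵘ
open import Data.Sum using (_⊎_; inj₁; inj₂)
open import Function using (_∘_; Equivalence)
open import Level using (0ℓ)
open import Relation.Binary using (Preorder; Setoid; Symmetric; Transitive; DecidableEquality; tri<; tri≈; tri>)
open import Relation.Binary.PropositionalEquality using
  (_≡_; _≢_; _≗_; ≢-sym; refl; sym; trans; cong; cong₂; subst; subst₂; setoid; _→-setoid_; resp₂; module ≡-Reasoning)
import Relation.Binary.Reasoning.Preorder as PreorderReasoning
open import Relation.Nullary using (yes; no; contradiction)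
open import Relation.Nullary.Decidable using (⌊_⌋)

private variable
  A B : Set
  n : ℕ

-- Arithmetic

0≤i*j : ∀ {i j} → 0ℤ ≤ i → 0ℤ ≤ j → 0ℤ ≤ i * j
0≤i*j {+ m} {+ n} _ _ = subst (0ℤ ≤_) (ℤ.pos-* m n) (ℤ.+≤+ ℕ.z≤n)

*-mono-≤ : ∀ {i j k l} → 0ℤ ≤ i → 0ℤ ≤ l → i ≤ j → k ≤ l → i * k ≤ j * l
*-mono-≤ {i} {l = l} 0≤i 0≤l i≤j k≤l =
  ℤ.≤-trans (ℤ.*-monoˡ-≤-nonNeg i {{ℤ.nonNegative 0≤i}} k≤l) (ℤ.*-monoʳ-≤-nonNeg l {{ℤ.nonNegative 0≤l}} i≤j)

pos-^ : ∀ n k → + (n ℕ.^ k) ≡ (+ n) ^ k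
pos-^ n zero    = refl
pos-^ n (suc k) = trans (ℤ.pos-* n (n ℕ.^ k)) (cong (+ n *_) (pos-^ n k))

pos-*-^ : ∀ c n k → + (c ℕ.* n ℕ.^ k) ≡ + c * (+ n) ^ k
pos-*-^ c n k = trans (ℤ.pos-* c (n ℕ.^ k)) (cong (+ c *_) (pos-^ n k))

0≤+n^k : ∀ n k → 0ℤ ≤ (+ n) ^ k
0≤+n^k n k = subst (0ℤ ≤_) (pos-^ n k) (ℤ.+≤+ ℕ.z≤n)

^-monoʳ-≤ : ∀ n {j k} → j ℕ.≤ k → (+ n) ^ suc j ≤ (+ n) ^ suc k
^-monoʳ-≤ n {j} {k} j≤k = subst₂ _≤_ (pos-^ n (suc j)) (pos-^ n (suc k)) (ℤ.+≤+ (mono n))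
  where
  mono : ∀ n → n ℕ.^ suc j ℕ.≤ n ℕ.^ suc k
  mono zero    = ℕ.z≤n
  mono (suc n) = ℕ.^-monoʳ-≤ (suc n) (ℕ.s≤s j≤k)

i*i≡∣i∣*∣i∣ : ∀ i → i * i ≡ + (∣ i ∣ ℕ.* ∣ i ∣)
i*i≡∣i∣*∣i∣ (+ m)    = sym (ℤ.pos-* m m)
i*i≡∣i∣*∣i∣ -[1+ m ] = refl

i≡-i⇒i≡0 : ∀ {i} → i ≡ - i → i ≡ 0ℤ
i≡-i⇒i≡0 {+ zero} _ = refl

∣i∣≤n⇒i≤n : ∀ i {n} → ∣ i ∣ ℕ.≤ n → i ≤ + n
∣i∣≤n⇒i≤n (+ _)    m≤n = ℤ.+≤+ m≤n
∣i∣≤n⇒i≤n -[1+ _ ] _   = ℤ.-≤+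

∣i∣≤n⇒-n≤i : ∀ i {n} → ∣ i ∣ ℕ.≤ n → - + n ≤ i
∣i∣≤n⇒-n≤i i {n} ∣i∣≤n = subst (- + n ≤_) (ℤ.neg-involutive i)
  (ℤ.neg-mono-≤ (∣i∣≤n⇒i≤n (- i) (subst (ℕ._≤ n) (sym (ℤ.∣-i∣≡∣i∣ i)) ∣i∣≤n)))

i≤n⇒-i≤n⇒∣i∣≤n : ∀ i {n} → i ≤ + n → - i ≤ + n → ∣ i ∣ ℕ.≤ n
i≤n⇒-i≤n⇒∣i∣≤n (+ _)    i≤n _    = ℤ.drop‿+≤+ i≤n
i≤n⇒-i≤n⇒∣i∣≤n -[1+ _ ] _   -i≤n = ℤ.drop‿+≤+ -i≤n

<⇒<ᵇ≡true : ∀ {i j} → i ℕ.< j → (i ℕ.<ᵇ j) ≡ true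
<⇒<ᵇ≡true = Equivalence.to T-≡ ∘ ℕ.<⇒<ᵇ

<ᵇ≡true⇒< : ∀ {i j} → (i ℕ.<ᵇ j) ≡ true → i ℕ.< j
<ᵇ≡true⇒< {i} {j} = ℕ.<ᵇ⇒< i j ∘ Equivalence.from T-≡

≥⇒<ᵇ≡false : ∀ {i j} → j ℕ.≤ i → (i ℕ.<ᵇ j) ≡ false
≥⇒<ᵇ≡false j≤i = ¬-not (ℕ.≤⇒≯ j≤i ∘ <ᵇ≡true⇒<)

<ᵇ≡false⇒≥ : ∀ {i j} → (i ℕ.<ᵇ j) ≡ false → j ℕ.≤ i
<ᵇ≡false⇒≥ i≮ᵇj = ℕ.≮⇒≥ (not-¬ i≮ᵇj ∘ <⇒<ᵇ≡true)

<ᵇ-not : ∀ {i j} → i ≢ j → (i ℕ.<ᵇ j) ≡ not (j ℕ.<ᵇ i)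
<ᵇ-not {i} {j} i≢j with ℕ.<-cmp i j
... | tri< i<j _ _ = trans (<⇒<ᵇ≡true i<j) (cong not (sym (≥⇒<ᵇ≡false (ℕ.<⇒≤ i<j))))
... | tri≈ _ i≡j _ = contradiction i≡j i≢j
... | tri> _ _ j<i = trans (≥⇒<ᵇ≡false (ℕ.<⇒≤ j<i)) (cong not (sym (<⇒<ᵇ≡true j<i)))

+-cancelˡ-<ᵇ : ∀ k i j → (k ℕ.+ i ℕ.<ᵇ k ℕ.+ j) ≡ (i ℕ.<ᵇ j)
+-cancelˡ-<ᵇ zero    i j = refl
+-cancelˡ-<ᵇ (suc k) i j = +-cancelˡ-<ᵇ k i j

sign : Bool → ℤ
sign true  = 1ℤ
sign false = - 1ℤ

sign*sign≡1 : ∀ b → sign b * sign b ≡ 1ℤ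
sign*sign≡1 true  = refl
sign*sign≡1 false = refl

∣sign∣≤1 : ∀ b → ∣ sign b ∣ ℕ.≤ 1
∣sign∣≤1 true  = ℕ.≤-refl
∣sign∣≤1 false = ℕ.≤-refl

sign-not : ∀ b → sign (not b) ≡ - sign b
sign-not true  = refl
sign-not false = refl

sign-xor : ∀ a b → sign (a xor b) ≡ - (sign a * sign b)
sign-xor true  b = trans (sign-not b) (cong -_ (sym (ℤ.*-identityˡ (sign b))))
sign-xor false b = trans (sym (ℤ.neg-involutive (sign b))) (cong -_ (sym (ℤ.-1*i≡-i (sign b))))

indicator : Bool → ℤ
indicator b = if b then 1ℤ else 0ℤ

0≤indicator : ∀ b → 0ℤ ≤ indicator b
0≤indicator true  = ℤ.+≤+ ℕ.z≤n
0≤indicator false = ℤ.≤-refl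

n*indicator≤n : ∀ n b → + n * indicator b ≤ + n
n*indicator≤n n true  = ℤ.≤-reflexive (ℤ.*-identityʳ (+ n))
n*indicator≤n n false = subst (_≤ + n) (sym (ℤ.*-zeroʳ (+ n))) (ℤ.+≤+ ℕ.z≤n)

indicator-∧ : ∀ a b → indicator (a ∧ b) ≡ indicator a * indicator b
indicator-∧ true  b = sym (ℤ.*-identityˡ (indicator b))
indicator-∧ false b = refl

indicator-∨-≤ : ∀ a b → indicator (a ∨ b) ≤ indicator a + indicator b
indicator-∨-≤ true  b = ℤ.+-monoʳ-≤ 1ℤ (0≤indicator b)
indicator-∨-≤ false b = ℤ.≤-reflexive (sym (ℤ.+-identityˡ (indicator b)))

-- Sums over lists

∑ : List A → (A → ℤ) → ℤ
∑ []       f = 0ℤ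
∑ (x ∷ xs) f = f x + ∑ xs f

infix 5 ∑
syntax ∑ xs (λ x → e) = ∑[ x ∈ xs ] e

∑-cong-All : ∀ {f g : A → ℤ} {xs} → All (λ x → f x ≡ g x) xs → ∑ xs f ≡ ∑ xs g
∑-cong-All []         = refl
∑-cong-All (eq ∷ eqs) = cong₂ _+_ eq (∑-cong-All eqs)

∑-cong : ∀ {f g : A → ℤ} xs → f ≗ g → ∑ xs f ≡ ∑ xs g
∑-cong xs f≗g = ∑-cong-All (All.universal f≗g xs)

∑-mono-All : ∀ {f g : A → ℤ} {xs} → All (λ x → f x ≤ g x) xs → ∑ xs f ≤ ∑ xs g
∑-mono-All []         = ℤ.≤-refl
∑-mono-All (le ∷ les) = ℤ.+-mono-≤ le (∑-mono-All les)

∑-mono : ∀ {f g : A → ℤ} xs → (∀ x → f x ≤ g x) → ∑ xs f ≤ ∑ xs g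
∑-mono xs f≤g = ∑-mono-All (All.universal f≤g xs)

∑-const : ∀ (xs : List A) c → (∑[ _ ∈ xs ] c) ≡ + length xs * c
∑-const []       c = sym (ℤ.*-zeroˡ c)
∑-const (x ∷ xs) c = trans (cong (λ s → c + s) (∑-const xs c)) (sym (ℤ.suc-* (+ length xs) c))

∑-zero : ∀ (xs : List A) → (∑[ _ ∈ xs ] 0ℤ) ≡ 0ℤ
∑-zero xs = trans (∑-const xs 0ℤ) (ℤ.*-zeroʳ (+ length xs))

∑-distrib-+ : ∀ xs (f g : A → ℤ) → (∑[ x ∈ xs ] f x + g x) ≡ ∑ xs f + ∑ xs g
∑-distrib-+ []       f g = refl
∑-distrib-+ (x ∷ xs) f g =
  trans (cong (λ s → f x + g x + s) (∑-distrib-+ xs f g)) (interchange (f x) (g x) (∑ xs f) (∑ xs g))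
  where
  interchange : ∀ a b c d → (a + b) + (c + d) ≡ (a + c) + (b + d)
  interchange = solve-∀

*-distribˡ-∑ : ∀ c xs (f : A → ℤ) → c * ∑ xs f ≡ (∑[ x ∈ xs ] c * f x)
*-distribˡ-∑ c []       f = ℤ.*-zeroʳ c
*-distribˡ-∑ c (x ∷ xs) f =
  trans (ℤ.*-distribˡ-+ c (f x) (∑ xs f)) (cong (λ s → c * f x + s) (*-distribˡ-∑ c xs f))

∑-comm : ∀ (xs : List A) (ys : List B) (f : A → B → ℤ) →
  (∑[ x ∈ xs ] ∑[ y ∈ ys ] f x y) ≡ (∑[ y ∈ ys ] ∑[ x ∈ xs ] f x y)
∑-comm []       ys f = sym (∑-zero ys)
∑-comm (x ∷ xs) ys f =
  trans (cong (λ s → ∑ ys (f x) + s) (∑-comm xs ys f)) (sym (∑-distrib-+ ys (f x) (λ y → ∑[ x′ ∈ xs ] f x′ y)))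

∑-++ : ∀ xs ys (f : A → ℤ) → ∑ (xs ++ ys) f ≡ ∑ xs f + ∑ ys f
∑-++ []       ys f = sym (ℤ.+-identityˡ (∑ ys f))
∑-++ (x ∷ xs) ys f =
  trans (cong (λ s → f x + s) (∑-++ xs ys f)) (sym (ℤ.+-assoc (f x) (∑ xs f) (∑ ys f)))

∑-map : ∀ (g : A → B) xs f → ∑ (map g xs) f ≡ (∑[ x ∈ xs ] f (g x))
∑-map g []       f = refl
∑-map g (x ∷ xs) f = cong (λ s → f (g x) + s) (∑-map g xs f)

∑-concatMap : ∀ (g : A → List B) xs f → ∑ (concatMap g xs) f ≡ (∑[ x ∈ xs ] ∑ (g x) f)
∑-concatMap g []       f = refl
∑-concatMap g (x ∷ xs) f =
  trans (∑-++ (g x) (concatMap g xs) f) (cong (λ s → ∑ (g x) f + s) (∑-concatMap g xs f))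

∣∑∣-≤ : ∀ xs {f : A → ℤ} {c} → (∀ x → ∣ f x ∣ ℕ.≤ c) → ∣ ∑ xs f ∣ ℕ.≤ length xs ℕ.* c
∣∑∣-≤ []           ∣f∣≤c = ℕ.z≤n
∣∑∣-≤ (x ∷ xs) {f} ∣f∣≤c =
  ℕ.≤-trans (ℤ.∣i+j∣≤∣i∣+∣j∣ (f x) (∑ xs f)) (ℕ.+-mono-≤ (∣f∣≤c x) (∣∑∣-≤ xs ∣f∣≤c))

length-allFin : ∀ n → length (allFin n) ≡ n
length-allFin n = List.length-tabulate {n = n} (λ i → i)

∑-allFin-const : ∀ n c → (∑[ _ ∈ allFin n ] c) ≡ + n * c
∑-allFin-const n c = trans (∑-const (allFin n) c) (cong (λ m → + m * c) (length-allFin n))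

∑-allFin-suc : ∀ n f → ∑ (allFin (suc n)) f ≡ f zero + (∑[ i ∈ allFin n ] f (suc i))
∑-allFin-suc n f = cong (λ s → f zero + s)
  (trans (cong (λ is → ∑ is f) (sym (List.map-tabulate (λ i → i) suc))) (∑-map suc (allFin n) f))

∑-allSeqs-suc : ∀ n k F → ∑ (allSeqs n (suc k)) F ≡ (∑[ x ∈ allFin n ] ∑[ xs ∈ allSeqs n k ] F (x ∷ xs))
∑-allSeqs-suc n k F = begin
  ∑ (allSeqs n (suc k)) F
    ≡⟨ ∑-concatMap _ (allSeqs n k) F ⟩
  (∑[ xs ∈ allSeqs n k ] ∑ (map (_∷ xs) (allFin n)) F)
    ≡⟨ ∑-cong (allSeqs n k) (λ xs → ∑-map (_∷ xs) (allFin n) F) ⟩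
  (∑[ xs ∈ allSeqs n k ] ∑[ x ∈ allFin n ] F (x ∷ xs))
    ≡⟨ ∑-comm (allSeqs n k) (allFin n) (λ xs x → F (x ∷ xs)) ⟩
  (∑[ x ∈ allFin n ] ∑[ xs ∈ allSeqs n k ] F (x ∷ xs)) ∎
  where open ≡-Reasoning

∑-allSeqs-const : ∀ n k c → (∑[ _ ∈ allSeqs n k ] c) ≡ (+ n) ^ k * c
∑-allSeqs-const n zero    c = trans (ℤ.+-identityʳ c) (sym (ℤ.*-identityˡ c))
∑-allSeqs-const n (suc k) c = begin
  (∑[ _ ∈ allSeqs n (suc k) ] c)                 ≡⟨ ∑-allSeqs-suc n k (λ _ → c) ⟩
  (∑[ _ ∈ allFin n ] ∑[ _ ∈ allSeqs n k ] c)     ≡⟨ ∑-cong (allFin n) (λ _ → ∑-allSeqs-const n k c) ⟩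
  (∑[ _ ∈ allFin n ] (+ n) ^ k * c)              ≡⟨ ∑-allFin-const n ((+ n) ^ k * c) ⟩
  + n * ((+ n) ^ k * c)                          ≡⟨ ℤ.*-assoc (+ n) ((+ n) ^ k) c ⟨
  (+ n) ^ suc k * c                              ∎
  where open ≡-Reasoning

All-concatMap⁺ : ∀ {Q : B → Set} {g : A → List B} {xs} → All (All Q ∘ g) xs → All Q (concatMap g xs)
All-concatMap⁺ = All.concat⁺ ∘ All.map⁺

length-allSeqs : ∀ n k → All (λ xs → length xs ≡ k) (allSeqs n k)
length-allSeqs n zero    = refl ∷ []
length-allSeqs n (suc k) = All-concatMap⁺
  (All.map (λ |xs|≡k → All.map⁺ (All.universal (λ _ → cong suc |xs|≡k) (allFin n))) (length-allSeqs n k))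

-- Permutations

insertions : A → List A → List (List A)
insertions x []       = [ x ∷ [] ]
insertions x (y ∷ ys) = (x ∷ y ∷ ys) ∷ map (y ∷_) (insertions x ys)

permutations : List A → List (List A)
permutations []       = [ [] ]
permutations (x ∷ xs) = concatMap (insertions x) (permutations xs)

insertions-↭ : ∀ (x : A) ys → All (_↭ x ∷ ys) (insertions x ys)
insertions-↭ x []       = ↭-refl ∷ []
insertions-↭ x (y ∷ ys) =
  ↭-refl ∷ All.map⁺ (All.map (λ zs↭ → ↭-trans (↭-prep y zs↭) (↭-swap y x ↭-refl)) (insertions-↭ x ys))

permutations-↭ : ∀ (xs : List A) → All (_↭ xs) (permutations xs)
permutations-↭ []       = ↭-refl ∷ []
permutations-↭ (x ∷ xs) = All-concatMap⁺ (All.map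
  (λ ys↭xs → All.map (λ zs↭ → ↭-trans zs↭ (↭-prep x ys↭xs)) (insertions-↭ x _)) (permutations-↭ xs))

insertions-map : ∀ (f : A → B) x ys → insertions (f x) (map f ys) ≡ map (map f) (insertions x ys)
insertions-map f x []       = refl
insertions-map f x (y ∷ ys) = cong (map f (x ∷ y ∷ ys) ∷_) (begin
  map (f y ∷_) (insertions (f x) (map f ys))       ≡⟨ cong (map (f y ∷_)) (insertions-map f x ys) ⟩
  map (f y ∷_) (map (map f) (insertions x ys))     ≡⟨ List.map-∘ (insertions x ys) ⟨
  map (map f ∘ (y ∷_)) (insertions x ys)           ≡⟨ List.map-∘ (insertions x ys) ⟩
  map (map f) (map (y ∷_) (insertions x ys))       ∎)
  where open ≡-Reasoning

permutations-map : ∀ (f : A → B) xs → permutations (map f xs) ≡ map (map f) (permutations xs)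
permutations-map f []       = refl
permutations-map f (x ∷ xs) = begin
  concatMap (insertions (f x)) (permutations (map f xs))
    ≡⟨ cong (concatMap (insertions (f x))) (permutations-map f xs) ⟩
  concatMap (insertions (f x)) (map (map f) (permutations xs))
    ≡⟨ List.concatMap-map (insertions (f x)) (map f) (permutations xs) ⟩
  concatMap (insertions (f x) ∘ map f) (permutations xs)
    ≡⟨ List.concatMap-cong (insertions-map f x) (permutations xs) ⟩
  concatMap (map (map f) ∘ insertions x) (permutations xs)
    ≡⟨ List.map-concatMap (map f) (insertions x) (permutations xs) ⟨
  map (map f) (permutations (x ∷ xs)) ∎
  where open ≡-Reasoning

length-insertions : ∀ (x : A) ys → length (insertions x ys) ≡ suc (length ys)
length-insertions x []       = refl
length-insertions x (y ∷ ys) = cong suc (trans (List.length-map (y ∷_) (insertions x ys)) (length-insertions x ys))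

length-concatMap : ∀ {f : A → List B} {m xs} → All (λ x → length (f x) ≡ m) xs →
  length (concatMap f xs) ≡ length xs ℕ.* m
length-concatMap                       []                = refl
length-concatMap {f = f} {xs = x ∷ xs} (|fx|≡m ∷ |f|≡m) =
  trans (List.length-++ (f x)) (cong₂ ℕ._+_ |fx|≡m (length-concatMap |f|≡m))

length-permutations : ∀ (xs : List A) → length (permutations xs) ≡ length xs !
length-permutations []       = refl
length-permutations (x ∷ xs) = begin
  length (permutations (x ∷ xs))
    ≡⟨ length-concatMap (All.map (λ {ys} ys↭xs → trans (length-insertions x ys) (cong suc (↭.↭-length ys↭xs)))
                                 (permutations-↭ xs)) ⟩
  length (permutations xs) ℕ.* suc (length xs)
    ≡⟨ cong (ℕ._* suc (length xs)) (length-permutations xs) ⟩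
  length xs ! ℕ.* suc (length xs)
    ≡⟨ ℕ.*-comm (length xs !) (suc (length xs)) ⟩
  suc (length xs) ! ∎
  where open ≡-Reasoning

∑-insertions-∷ : ∀ (x y : A) ys F →
  ∑ (insertions x (y ∷ ys)) F ≡ F (x ∷ y ∷ ys) + (∑[ zs ∈ insertions x ys ] F (y ∷ zs))
∑-insertions-∷ x y ys F = cong (λ s → F (x ∷ y ∷ ys) + s) (∑-map (y ∷_) (insertions x ys) F)

∑-insertions-comm : ∀ (x y : A) zs F →
  (∑[ ys ∈ insertions y zs ] ∑ (insertions x ys) F) ≡ (∑[ xs ∈ insertions x zs ] ∑ (insertions y xs) F)
∑-insertions-comm x y []       F = exchange (F (x ∷ y ∷ [])) (F (y ∷ x ∷ []))
  where
  exchange : ∀ a b → (a + (b + 0ℤ)) + 0ℤ ≡ (b + (a + 0ℤ)) + 0ℤ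
  exchange = solve-∀
∑-insertions-comm {A = A} x y (z ∷ zs) F = begin
  (∑[ ys ∈ insertions y (z ∷ zs) ] ∑ (insertions x ys) F)
    ≡⟨ expand x y ⟩
  expanded x y (∑[ ys ∈ insertions y zs ] ∑[ xs ∈ insertions x ys ] F (z ∷ xs))
    ≡⟨ cong (expanded x y) (∑-insertions-comm x y zs (F ∘ (z ∷_))) ⟩
  expanded x y (∑[ xs ∈ insertions x zs ] ∑[ ys ∈ insertions y xs ] F (z ∷ ys))
    ≡⟨ exchange (F (x ∷ y ∷ z ∷ zs)) (F (y ∷ x ∷ z ∷ zs)) _ _ _ ⟩
  expanded y x (∑[ xs ∈ insertions x zs ] ∑[ ys ∈ insertions y xs ] F (z ∷ ys))
    ≡⟨ expand y x ⟨
  (∑[ xs ∈ insertions x (z ∷ zs) ] ∑ (insertions y xs) F) ∎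
  where
  open ≡-Reasoning
  expanded : A → A → ℤ → ℤ
  expanded x y s = (F (x ∷ y ∷ z ∷ zs) + (F (y ∷ x ∷ z ∷ zs) + (∑[ xs ∈ insertions x zs ] F (y ∷ z ∷ xs))))
                   + ((∑[ ys ∈ insertions y zs ] F (x ∷ z ∷ ys)) + s)
  exchange : ∀ a b c d e → (a + (b + c)) + (d + e) ≡ (b + (a + d)) + (c + e)
  exchange = solve-∀
  expand : ∀ x y → (∑[ ys ∈ insertions y (z ∷ zs) ] ∑ (insertions x ys) F)
    ≡ expanded x y (∑[ ys ∈ insertions y zs ] ∑[ xs ∈ insertions x ys ] F (z ∷ xs))
  expand x y = begin
    (∑[ ys ∈ insertions y (z ∷ zs) ] ∑ (insertions x ys) F)
      ≡⟨ ∑-insertions-∷ y z zs (λ ys → ∑ (insertions x ys) F) ⟩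
    ∑ (insertions x (y ∷ z ∷ zs)) F + (∑[ ys ∈ insertions y zs ] ∑ (insertions x (z ∷ ys)) F)
      ≡⟨ cong₂ _+_
           (trans (∑-insertions-∷ x y (z ∷ zs) F)
                  (cong (λ s → F (x ∷ y ∷ z ∷ zs) + s) (∑-insertions-∷ x z zs (F ∘ (y ∷_)))))
           (trans (∑-cong (insertions y zs) (λ ys → ∑-insertions-∷ x z ys F))
                  (∑-distrib-+ (insertions y zs) _ _)) ⟩
    expanded x y (∑[ ys ∈ insertions y zs ] ∑[ xs ∈ insertions x ys ] F (z ∷ xs)) ∎

∑-permutations-∷∷ : ∀ (x y : A) zs F → ∑ (permutations (x ∷ y ∷ zs)) F
  ≡ (∑[ ws ∈ permutations zs ] ∑[ ys ∈ insertions y ws ] ∑ (insertions x ys) F)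
∑-permutations-∷∷ x y zs F =
  trans (∑-concatMap (insertions x) (permutations (y ∷ zs)) F) (∑-concatMap (insertions y) (permutations zs) _)

∑-permutations-resp-↭ : ∀ {xs ys : List A} F → xs ↭ ys → ∑ (permutations xs) F ≡ ∑ (permutations ys) F
∑-permutations-resp-↭ F ↭.refl        = refl
∑-permutations-resp-↭ F (↭.trans p q) = trans (∑-permutations-resp-↭ F p) (∑-permutations-resp-↭ F q)
∑-permutations-resp-↭ {xs = _ ∷ xs} {_ ∷ ys} F (↭.prep x p) = begin
  ∑ (permutations (x ∷ xs)) F                           ≡⟨ ∑-concatMap (insertions x) (permutations xs) F ⟩
  (∑[ zs ∈ permutations xs ] ∑ (insertions x zs) F)     ≡⟨ ∑-permutations-resp-↭ _ p ⟩
  (∑[ zs ∈ permutations ys ] ∑ (insertions x zs) F)     ≡⟨ ∑-concatMap (insertions x) (permutations ys) F ⟨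
  ∑ (permutations (x ∷ ys)) F                           ∎
  where open ≡-Reasoning
∑-permutations-resp-↭ {xs = _ ∷ _ ∷ xs} {_ ∷ _ ∷ ys} F (↭.swap x y p) = begin
  ∑ (permutations (x ∷ y ∷ xs)) F
    ≡⟨ ∑-permutations-∷∷ x y xs F ⟩
  (∑[ zs ∈ permutations xs ] ∑[ ws ∈ insertions y zs ] ∑ (insertions x ws) F)
    ≡⟨ ∑-cong (permutations xs) (λ zs → ∑-insertions-comm x y zs F) ⟩
  (∑[ zs ∈ permutations xs ] ∑[ ws ∈ insertions x zs ] ∑ (insertions y ws) F)
    ≡⟨ ∑-permutations-resp-↭ _ p ⟩
  (∑[ zs ∈ permutations ys ] ∑[ ws ∈ insertions x zs ] ∑ (insertions y ws) F)
    ≡⟨ ∑-permutations-∷∷ y x ys F ⟨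
  ∑ (permutations (y ∷ x ∷ ys)) F ∎
  where open ≡-Reasoning

∑-allSeqs-insertions : ∀ n k F →
  (∑[ x ∈ allFin n ] ∑[ xs ∈ allSeqs n k ] ∑ (insertions x xs) F) ≡ + suc k * ∑ (allSeqs n (suc k)) F
∑-allSeqs-insertions n zero    F = begin
  (∑[ x ∈ allFin n ] (F (x ∷ []) + 0ℤ) + 0ℤ)     ≡⟨ ∑-cong (allFin n) (λ x → ℤ.+-identityʳ (F (x ∷ []) + 0ℤ)) ⟩
  (∑[ x ∈ allFin n ] F (x ∷ []) + 0ℤ)            ≡⟨ ∑-allSeqs-suc n 0 F ⟨
  ∑ (allSeqs n 1) F                              ≡⟨ ℤ.*-identityˡ _ ⟨
  1ℤ * ∑ (allSeqs n 1) F                         ∎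
  where open ≡-Reasoning
∑-allSeqs-insertions n (suc k) F = begin
  (∑[ x ∈ allFin n ] ∑[ xs ∈ allSeqs n (suc k) ] ∑ (insertions x xs) F)
    ≡⟨ ∑-cong (allFin n) (λ x → trans (∑-allSeqs-suc n k _)
                                (trans (∑-cong (allFin n) (splitFirst x)) (∑-distrib-+ (allFin n) _ _))) ⟩
  (∑[ x ∈ allFin n ] (∑[ y ∈ allFin n ] ∑[ ys ∈ allSeqs n k ] F (x ∷ y ∷ ys))
                     + (∑[ y ∈ allFin n ] ∑[ ys ∈ allSeqs n k ] ∑[ zs ∈ insertions x ys ] F (y ∷ zs)))
    ≡⟨ ∑-distrib-+ (allFin n) _ _ ⟩
  (∑[ x ∈ allFin n ] ∑[ y ∈ allFin n ] ∑[ ys ∈ allSeqs n k ] F (x ∷ y ∷ ys))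
    + (∑[ x ∈ allFin n ] ∑[ y ∈ allFin n ] ∑[ ys ∈ allSeqs n k ] ∑[ zs ∈ insertions x ys ] F (y ∷ zs))
    ≡⟨ cong₂ _+_ first rest ⟩
  S + + suc k * S
    ≡⟨ ℤ.suc-* (+ suc k) S ⟨
  + suc (suc k) * S ∎
  where
  open ≡-Reasoning
  S : ℤ
  S = ∑ (allSeqs n (suc (suc k))) F
  splitFirst : ∀ x y → (∑[ ys ∈ allSeqs n k ] ∑ (insertions x (y ∷ ys)) F)
    ≡ (∑[ ys ∈ allSeqs n k ] F (x ∷ y ∷ ys)) + (∑[ ys ∈ allSeqs n k ] ∑[ zs ∈ insertions x ys ] F (y ∷ zs))
  splitFirst x y = trans (∑-cong (allSeqs n k) (λ ys → ∑-insertions-∷ x y ys F)) (∑-distrib-+ (allSeqs n k) _ _)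
  first : (∑[ x ∈ allFin n ] ∑[ y ∈ allFin n ] ∑[ ys ∈ allSeqs n k ] F (x ∷ y ∷ ys)) ≡ S
  first = sym (trans (∑-allSeqs-suc n (suc k) F) (∑-cong (allFin n) (λ x → ∑-allSeqs-suc n k (F ∘ (x ∷_)))))
  rest : (∑[ x ∈ allFin n ] ∑[ y ∈ allFin n ] ∑[ ys ∈ allSeqs n k ] ∑[ zs ∈ insertions x ys ] F (y ∷ zs)) ≡ + suc k * S
  rest = begin
    (∑[ x ∈ allFin n ] ∑[ y ∈ allFin n ] ∑[ ys ∈ allSeqs n k ] ∑[ zs ∈ insertions x ys ] F (y ∷ zs))
      ≡⟨ ∑-comm (allFin n) (allFin n) _ ⟩
    (∑[ y ∈ allFin n ] ∑[ x ∈ allFin n ] ∑[ ys ∈ allSeqs n k ] ∑[ zs ∈ insertions x ys ] F (y ∷ zs))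
      ≡⟨ ∑-cong (allFin n) (λ y → ∑-allSeqs-insertions n k (F ∘ (y ∷_))) ⟩
    (∑[ y ∈ allFin n ] + suc k * (∑[ xs ∈ allSeqs n (suc k) ] F (y ∷ xs)))
      ≡⟨ *-distribˡ-∑ (+ suc k) (allFin n) _ ⟨
    + suc k * (∑[ y ∈ allFin n ] ∑[ xs ∈ allSeqs n (suc k) ] F (y ∷ xs))
      ≡⟨ cong (+ suc k *_) (∑-allSeqs-suc n (suc k) F) ⟨
    + suc k * S ∎

∑-allSeqs-permutations : ∀ n k F → (∑[ xs ∈ allSeqs n k ] ∑ (permutations xs) F) ≡ + (k !) * ∑ (allSeqs n k) F
∑-allSeqs-permutations n zero    F = singleton (F [])
  where
  singleton : ∀ a → (a + 0ℤ) + 0ℤ ≡ 1ℤ * (a + 0ℤ)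
  singleton = solve-∀
∑-allSeqs-permutations n (suc k) F = begin
  (∑[ xs ∈ allSeqs n (suc k) ] ∑ (permutations xs) F)
    ≡⟨ ∑-allSeqs-suc n k _ ⟩
  (∑[ x ∈ allFin n ] ∑[ xs ∈ allSeqs n k ] ∑ (permutations (x ∷ xs)) F)
    ≡⟨ ∑-cong (allFin n) (λ x → ∑-cong (allSeqs n k) λ xs → ∑-concatMap (insertions x) (permutations xs) F) ⟩
  (∑[ x ∈ allFin n ] ∑[ xs ∈ allSeqs n k ] ∑[ ys ∈ permutations xs ] ∑ (insertions x ys) F)
    ≡⟨ ∑-cong (allFin n) (λ x → ∑-allSeqs-permutations n k (λ ys → ∑ (insertions x ys) F)) ⟩
  (∑[ x ∈ allFin n ] + (k !) * (∑[ xs ∈ allSeqs n k ] ∑ (insertions x xs) F))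
    ≡⟨ *-distribˡ-∑ (+ (k !)) (allFin n) _ ⟨
  + (k !) * (∑[ x ∈ allFin n ] ∑[ xs ∈ allSeqs n k ] ∑ (insertions x xs) F)
    ≡⟨ cong (+ (k !) *_) (∑-allSeqs-insertions n k F) ⟩
  + (k !) * (+ suc k * ∑ (allSeqs n (suc k)) F)
    ≡⟨ ℤ.*-assoc (+ (k !)) (+ suc k) _ ⟨
  + (k !) * + suc k * ∑ (allSeqs n (suc k)) F
    ≡⟨ cong (_* ∑ (allSeqs n (suc k)) F) (trans (cong +_ (ℕ.*-comm (suc k) (k !))) (ℤ.pos-* (k !) (suc k))) ⟨
  + (suc k !) * ∑ (allSeqs n (suc k)) F ∎
  where open ≡-Reasoning

-- Matrices and traces

Vector : ℕ → Set
Vector n = Fin n → ℤ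

Matrix : ℕ → Set
Matrix n = Fin n → Fin n → ℤ

𝟏 : Vector n
𝟏 _ = 1ℤ

sumᵛ : Vector n → ℤ
sumᵛ f = ∑ (allFin _) f

infixr 8 _·_
_·_ : Matrix n → Vector n → Vector n
(A · f) x = ∑[ y ∈ allFin _ ] A x y * f y

power : Matrix n → ℕ → Vector n → Vector n
power A zero    f = f
power A (suc k) f = A · power A k f

module _ {n : ℕ} (A : Matrix n) where

  ·-cong : ∀ {f g} → f ≗ g → A · f ≗ A · g
  ·-cong f≗g x = ∑-cong (allFin n) λ y → cong (A x y *_) (f≗g y)

  ·-linear : ∀ c f g → A · (λ y → c * f y + g y) ≗ λ x → c * (A · f) x + (A · g) x
  ·-linear c f g x = begin
    (∑[ y ∈ allFin n ] A x y * (c * f y + g y))             ≡⟨ ∑-cong (allFin n) (λ y → distrib (A x y) c (f y) (g y)) ⟩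
    (∑[ y ∈ allFin n ] c * (A x y * f y) + A x y * g y)     ≡⟨ ∑-distrib-+ (allFin n) _ _ ⟩
    (∑[ y ∈ allFin n ] c * (A x y * f y)) + (A · g) x       ≡⟨ cong (_+ (A · g) x) (*-distribˡ-∑ c (allFin n) _) ⟨
    c * (A · f) x + (A · g) x                               ∎
    where
    open ≡-Reasoning
    distrib : ∀ a c f g → a * (c * f + g) ≡ c * (a * f) + a * g
    distrib = solve-∀

  power-cong : ∀ k {f g} → f ≗ g → power A k f ≗ power A k g
  power-cong zero    f≗g = f≗g
  power-cong (suc k) f≗g = ·-cong (power-cong k f≗g)

  power-· : ∀ k f → power A k (A · f) ≗ A · power A k f
  power-· zero    f x = refl
  power-· (suc k) f   = ·-cong (power-· k f)

  power-linear : ∀ k c f g → power A k (λ y → c * f y + g y) ≗ λ x → c * power A k f x + power A k g x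
  power-linear zero    c f g x = refl
  power-linear (suc k) c f g x =
    trans (·-cong (power-linear k c f g) x) (·-linear c (power A k f) (power A k g) x)

  power-zero : ∀ k x → power A k (λ _ → 0ℤ) x ≡ 0ℤ
  power-zero zero    x = refl
  power-zero (suc k) x = begin
    (∑[ y ∈ allFin n ] A x y * power A k (λ _ → 0ℤ) y)  ≡⟨ ∑-cong (allFin n) (λ y → cong (A x y *_) (power-zero k y)) ⟩
    (∑[ y ∈ allFin n ] A x y * 0ℤ)                      ≡⟨ ∑-cong (allFin n) (λ y → ℤ.*-zeroʳ (A x y)) ⟩
    (∑[ _ ∈ allFin n ] 0ℤ)                              ≡⟨ ∑-zero (allFin n) ⟩
    0ℤ                                                  ∎
    where open ≡-Reasoning

  power-∑ : ∀ k zs (c : Vector n) (f : Fin n → Vector n) x →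
    power A k (λ y → ∑[ z ∈ zs ] c z * f z y) x ≡ (∑[ z ∈ zs ] c z * power A k (f z) x)
  power-∑ k []       c f x = power-zero k x
  power-∑ k (z ∷ zs) c f x =
    trans (power-linear k (c z) (f z) _ x) (cong (λ s → c z * power A k (f z) x + s) (power-∑ k zs c f x))

column : Matrix n → Fin n → Vector n
column A z x = A x z

-- Indices are shifted: trace A k is tr Aᵏ⁺¹.
trace : Matrix n → ℕ → ℤ
trace A k = ∑[ z ∈ allFin _ ] power A k (column A z) z

J+_ : Matrix n → Matrix n
(J+ K) x y = 1ℤ + K x y

-- If μ k = uᵀ Kᵏ u, where u = 𝟏, then mixedMoment a j = uᵀ (J + K)ʲ Kᵃ u, because J = u uᵀ, and
-- excess k = tr (J + K)ᵏ⁺¹ − tr Kᵏ⁺¹. The ring operations are parameters so that these recursions can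
-- also be run on the polynomials of the ring solver.
module Expansion {X : Set} (_⊕_ _⊗_ : X → X → X) (μ : ℕ → X) where

  mixedMoment : ℕ → ℕ → X
  mixedMoment a zero    = μ a
  mixedMoment a (suc j) = (μ a ⊗ mixedMoment 0 j) ⊕ mixedMoment (suc a) j

  excessFrom : ℕ → ℕ → X
  excessFrom a zero    = μ a
  excessFrom a (suc j) = mixedMoment a (suc j) ⊕ excessFrom (suc a) j

  excess : ℕ → X
  excess = excessFrom 0

open Expansion _+_ _*_ using (mixedMoment; excessFrom; excess)

mixedMoment-cong : ∀ {μ ν} → μ ≗ ν → ∀ a j → mixedMoment μ a j ≡ mixedMoment ν a j
mixedMoment-cong μ≗ν a zero    = μ≗ν a
mixedMoment-cong μ≗ν a (suc j) =
  cong₂ _+_ (cong₂ _*_ (μ≗ν a) (mixedMoment-cong μ≗ν 0 j)) (mixedMoment-cong μ≗ν (suc a) j)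

excessFrom-cong : ∀ {μ ν} → μ ≗ ν → ∀ a j → excessFrom μ a j ≡ excessFrom ν a j
excessFrom-cong μ≗ν a zero    = μ≗ν a
excessFrom-cong μ≗ν a (suc j) = cong₂ _+_ (mixedMoment-cong μ≗ν a (suc j)) (excessFrom-cong μ≗ν (suc a) j)

module _ {n : ℕ} (K : Matrix n) where

  private
    M : Matrix n
    M = J+ K

    h : ℕ → Vector n
    h k = power K k 𝟏

  moment : ℕ → ℤ
  moment k = sumᵛ (power K k 𝟏)

  power-J+ : ∀ a f → power K a (M · f) ≗ λ x → sumᵛ f * h a x + power K (suc a) f x
  power-J+ a f x = begin
    power K a (M · f) x                                  ≡⟨ power-cong K a split x ⟩
    power K a (λ y → sumᵛ f * 1ℤ + (K · f) y) x          ≡⟨ power-linear K a (sumᵛ f) 𝟏 (K · f) x ⟩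
    sumᵛ f * h a x + power K a (K · f) x                 ≡⟨ cong (λ s → sumᵛ f * h a x + s) (power-· K a f x) ⟩
    sumᵛ f * h a x + power K (suc a) f x                 ∎
    where
    open ≡-Reasoning
    distrib : ∀ k f → (1ℤ + k) * f ≡ f + k * f
    distrib = solve-∀
    split : M · f ≗ λ y → sumᵛ f * 1ℤ + (K · f) y
    split y = begin
      (∑[ z ∈ allFin n ] (1ℤ + K y z) * f z)     ≡⟨ ∑-cong (allFin n) (λ z → distrib (K y z) (f z)) ⟩
      (∑[ z ∈ allFin n ] f z + K y z * f z)      ≡⟨ ∑-distrib-+ (allFin n) _ _ ⟩
      sumᵛ f + (K · f) y                         ≡⟨ cong (_+ (K · f) y) (ℤ.*-identityʳ (sumᵛ f)) ⟨
      sumᵛ f * 1ℤ + (K · f) y                    ∎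

  sumᵛ-power : ∀ a j → sumᵛ (power M j (h a)) ≡ mixedMoment moment a j
  sumᵛ-power a zero    = refl
  sumᵛ-power a (suc j) = begin
    sumᵛ (power M (suc j) (h a))
      ≡⟨ ∑-cong (allFin n) (power-· M j (h a)) ⟨
    sumᵛ (power M j (M · h a))
      ≡⟨ ∑-cong (allFin n) (λ x → trans (power-cong M j (power-J+ 0 (h a)) x)
                                  (power-linear M j (moment a) 𝟏 (h (suc a)) x)) ⟩
    (∑[ x ∈ allFin n ] moment a * power M j 𝟏 x + power M j (h (suc a)) x)
      ≡⟨ ∑-distrib-+ (allFin n) _ _ ⟩
    (∑[ x ∈ allFin n ] moment a * power M j 𝟏 x) + sumᵛ (power M j (h (suc a)))
      ≡⟨ cong (_+ sumᵛ (power M j (h (suc a)))) (*-distribˡ-∑ (moment a) (allFin n) _) ⟨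
    moment a * sumᵛ (power M j 𝟏) + sumᵛ (power M j (h (suc a)))
      ≡⟨ cong₂ _+_ (cong (moment a *_) (sumᵛ-power 0 j)) (sumᵛ-power (suc a) j) ⟩
    mixedMoment moment a (suc j) ∎
    where open ≡-Reasoning

  ∑-sumᵛ-column : ∀ a j →
    (∑[ z ∈ allFin n ] sumᵛ (power M j (column M z)) * h a z) ≡ mixedMoment moment a (suc j)
  ∑-sumᵛ-column a j = begin
    (∑[ z ∈ allFin n ] sumᵛ (power M j (column M z)) * h a z)
      ≡⟨ ∑-cong (allFin n) (λ z → trans (ℤ.*-comm _ (h a z)) (*-distribˡ-∑ (h a z) (allFin n) _)) ⟩
    (∑[ z ∈ allFin n ] ∑[ x ∈ allFin n ] h a z * power M j (column M z) x)
      ≡⟨ ∑-comm (allFin n) (allFin n) _ ⟩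
    (∑[ x ∈ allFin n ] ∑[ z ∈ allFin n ] h a z * power M j (column M z) x)
      ≡⟨ ∑-cong (allFin n) (power-∑ M j (allFin n) (h a) (column M)) ⟨
    sumᵛ (power M j (λ x → ∑[ z ∈ allFin n ] h a z * M x z))
      ≡⟨ ∑-cong (allFin n) (power-cong M j λ x → ∑-cong (allFin n) λ z → ℤ.*-comm (h a z) (M x z)) ⟩
    sumᵛ (power M j (M · h a))
      ≡⟨ ∑-cong (allFin n) (power-· M j (h a)) ⟩
    sumᵛ (power M (suc j) (h a))
      ≡⟨ sumᵛ-power a (suc j) ⟩
    mixedMoment moment a (suc j) ∎
    where open ≡-Reasoning

  mixedTrace : ℕ → ℕ → ℤ
  mixedTrace a j = ∑[ z ∈ allFin n ] power K a (power M j (column M z)) z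

  mixedTrace-excess : ∀ a j → mixedTrace a j ≡ excessFrom moment a j + trace K (a ℕ.+ j)
  mixedTrace-excess a zero = begin
    mixedTrace a 0
      ≡⟨ ∑-cong (allFin n) (λ z → power-linear K a 1ℤ 𝟏 (column K z) z) ⟩
    (∑[ z ∈ allFin n ] 1ℤ * h a z + power K a (column K z) z)
      ≡⟨ ∑-distrib-+ (allFin n) _ _ ⟩
    (∑[ z ∈ allFin n ] 1ℤ * h a z) + trace K a
      ≡⟨ cong (_+ trace K a) (∑-cong (allFin n) λ z → ℤ.*-identityˡ (h a z)) ⟩
    moment a + trace K a
      ≡⟨ cong (λ k → moment a + trace K k) (ℕ.+-identityʳ a) ⟨
    moment a + trace K (a ℕ.+ 0) ∎
    where open ≡-Reasoning
  mixedTrace-excess a (suc j) = begin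
    mixedTrace a (suc j)
      ≡⟨ ∑-cong (allFin n) (λ z → power-J+ a (power M j (column M z)) z) ⟩
    (∑[ z ∈ allFin n ] sumᵛ (power M j (column M z)) * h a z + power K (suc a) (power M j (column M z)) z)
      ≡⟨ ∑-distrib-+ (allFin n) _ _ ⟩
    (∑[ z ∈ allFin n ] sumᵛ (power M j (column M z)) * h a z) + mixedTrace (suc a) j
      ≡⟨ cong₂ _+_ (∑-sumᵛ-column a j) (mixedTrace-excess (suc a) j) ⟩
    mixedMoment moment a (suc j) + (excessFrom moment (suc a) j + trace K (suc a ℕ.+ j))
      ≡⟨ ℤ.+-assoc (mixedMoment moment a (suc j)) _ _ ⟨
    excessFrom moment a (suc j) + trace K (suc a ℕ.+ j)
      ≡⟨ cong (λ k → excessFrom moment a (suc j) + trace K k) (ℕ.+-suc a j) ⟨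
    excessFrom moment a (suc j) + trace K (a ℕ.+ suc j) ∎
    where open ≡-Reasoning

  trace-J+ : ∀ k → trace (J+ K) k ≡ excess moment k + trace K k
  trace-J+ = mixedTrace-excess 0

-- Skew-symmetric matrices

⟨_,_⟩ : Vector n → Vector n → ℤ
⟨ f , g ⟩ = sumᵛ λ x → f x * g x

‖_‖² : Vector n → ℤ
‖ f ‖² = ⟨ f , f ⟩

module _ {n : ℕ} where

  ⟨⟩-comm : ∀ (f g : Vector n) → ⟨ f , g ⟩ ≡ ⟨ g , f ⟩
  ⟨⟩-comm f g = ∑-cong (allFin n) λ x → ℤ.*-comm (f x) (g x)

  ⟨⟩-congʳ : ∀ (f : Vector n) {g g′} → g ≗ g′ → ⟨ f , g ⟩ ≡ ⟨ f , g′ ⟩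
  ⟨⟩-congʳ f g≗g′ = ∑-cong (allFin n) λ x → cong (f x *_) (g≗g′ x)

  ‖‖²-cong : ∀ {f f′ : Vector n} → f ≗ f′ → ‖ f ‖² ≡ ‖ f′ ‖²
  ‖‖²-cong f≗f′ = ∑-cong (allFin n) λ x → cong (λ a → a * a) (f≗f′ x)

  0≤‖‖² : ∀ (f : Vector n) → 0ℤ ≤ ‖ f ‖²
  0≤‖‖² f = subst (_≤ ‖ f ‖²) (∑-zero (allFin n))
    (∑-mono (allFin n) λ x → subst (0ℤ ≤_) (sym (i*i≡∣i∣*∣i∣ (f x))) (ℤ.+≤+ ℕ.z≤n))

  ‖af+bg‖² : ∀ a b (f g : Vector n) →
    ‖ (λ x → a * f x + b * g x) ‖² ≡ a * a * ‖ f ‖² + + 2 * a * b * ⟨ f , g ⟩ + b * b * ‖ g ‖²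
  ‖af+bg‖² a b f g = begin
    ‖ (λ x → a * f x + b * g x) ‖²
      ≡⟨ ∑-cong (allFin n) (λ x → square a b (f x) (g x)) ⟩
    (∑[ x ∈ allFin n ] a * a * (f x * f x) + + 2 * a * b * (f x * g x) + b * b * (g x * g x))
      ≡⟨ ∑-distrib-+ (allFin n) _ _ ⟩
    (∑[ x ∈ allFin n ] a * a * (f x * f x) + + 2 * a * b * (f x * g x)) + (∑[ x ∈ allFin n ] b * b * (g x * g x))
      ≡⟨ cong₂ _+_ (∑-distrib-+ (allFin n) _ _) (sym (*-distribˡ-∑ (b * b) (allFin n) _)) ⟩
    (∑[ x ∈ allFin n ] a * a * (f x * f x)) + (∑[ x ∈ allFin n ] + 2 * a * b * (f x * g x)) + b * b * ‖ g ‖²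
      ≡⟨ cong₂ (λ s t → s + t + b * b * ‖ g ‖²)
               (*-distribˡ-∑ (a * a) (allFin n) _) (*-distribˡ-∑ (+ 2 * a * b) (allFin n) _) ⟨
    a * a * ‖ f ‖² + + 2 * a * b * ⟨ f , g ⟩ + b * b * ‖ g ‖² ∎
    where
    open ≡-Reasoning
    square : ∀ a b x y →
      (a * x + b * y) * (a * x + b * y) ≡ a * a * (x * x) + + 2 * a * b * (x * y) + b * b * (y * y)
    square = solve-∀

Skew : Matrix n → Set
Skew K = ∀ x y → K y x ≡ - K x y

module Alternation {X : Set} (neg : X → X) (0# : X) where

  alternate : (ℕ → X) → ℕ → X
  alternate e zero          = e 0
  alternate e (suc zero)    = 0#
  alternate e (suc (suc k)) = neg (alternate (e ∘ suc) k)

open Alternation -_ 0ℤ using (alternate)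

alternate-cong : ∀ {e e′} → e ≗ e′ → alternate e ≗ alternate e′
alternate-cong e≗e′ zero          = e≗e′ 0
alternate-cong e≗e′ (suc zero)    = refl
alternate-cong e≗e′ (suc (suc k)) = cong -_ (alternate-cong (e≗e′ ∘ suc) k)

module _ {n : ℕ} (K : Matrix n) (skew : Skew K) where

  ·-antiadjoint : ∀ f g → ⟨ f , K · g ⟩ ≡ - ⟨ K · f , g ⟩
  ·-antiadjoint f g = begin
    (∑[ x ∈ allFin n ] f x * (K · g) x)
      ≡⟨ ∑-cong (allFin n) (λ x → *-distribˡ-∑ (f x) (allFin n) _) ⟩
    (∑[ x ∈ allFin n ] ∑[ y ∈ allFin n ] f x * (K x y * g y))
      ≡⟨ ∑-comm (allFin n) (allFin n) _ ⟩
    (∑[ y ∈ allFin n ] ∑[ x ∈ allFin n ] f x * (K x y * g y))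
      ≡⟨ ∑-cong (allFin n) (λ y → ∑-cong (allFin n) λ x → moveSign (f x) (g y) (skew y x)) ⟩
    (∑[ y ∈ allFin n ] ∑[ x ∈ allFin n ] - 1ℤ * g y * (K y x * f x))
      ≡⟨ ∑-cong (allFin n) (λ y → *-distribˡ-∑ (- 1ℤ * g y) (allFin n) _) ⟨
    (∑[ y ∈ allFin n ] - 1ℤ * g y * (K · f) y)
      ≡⟨ ∑-cong (allFin n) (λ y → exchange (g y) ((K · f) y)) ⟩
    (∑[ y ∈ allFin n ] - 1ℤ * ((K · f) y * g y))
      ≡⟨ *-distribˡ-∑ (- 1ℤ) (allFin n) _ ⟨
    - 1ℤ * ⟨ K · f , g ⟩
      ≡⟨ ℤ.-1*i≡-i _ ⟩
    - ⟨ K · f , g ⟩ ∎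
    where
    open ≡-Reasoning
    moveSign : ∀ f g {k l} → l ≡ - k → f * (l * g) ≡ - 1ℤ * g * (k * f)
    moveSign f g {k} refl = regroup f g k
      where
      regroup : ∀ f g k → f * (- k * g) ≡ - 1ℤ * g * (k * f)
      regroup = solve-∀
    exchange : ∀ g k → - 1ℤ * g * k ≡ - 1ℤ * (k * g)
    exchange = solve-∀

  ⟨f,Kᵏf⟩-alternate : ∀ f k → ⟨ f , power K k f ⟩ ≡ alternate (λ j → ‖ power K j f ‖²) k
  ⟨f,Kᵏf⟩-alternate f zero          = refl
  ⟨f,Kᵏf⟩-alternate f (suc zero)    = i≡-i⇒i≡0 (trans (·-antiadjoint f f) (cong -_ (⟨⟩-comm (K · f) f)))
  ⟨f,Kᵏf⟩-alternate f (suc (suc k)) = begin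
    ⟨ f , K · power K (suc k) f ⟩                       ≡⟨ ·-antiadjoint f (power K (suc k) f) ⟩
    - ⟨ K · f , K · power K k f ⟩                       ≡⟨ cong -_ (⟨⟩-congʳ (K · f) (power-· K k f)) ⟨
    - ⟨ K · f , power K k (K · f) ⟩                     ≡⟨ cong -_ (⟨f,Kᵏf⟩-alternate (K · f) k) ⟩
    - alternate (λ j → ‖ power K j (K · f) ‖²) k        ≡⟨ cong -_ (alternate-cong (‖‖²-cong ∘ λ j → power-· K j f) k) ⟩
    - alternate (λ j → ‖ power K (suc j) f ‖²) k        ∎
    where open ≡-Reasoning

  moment-alternate : moment K ≗ alternate (λ j → ‖ power K j 𝟏 ‖²)
  moment-alternate k =
    trans (∑-cong (allFin n) λ x → sym (ℤ.*-identityˡ (power K k 𝟏 x))) (⟨f,Kᵏf⟩-alternate 𝟏 k)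

  excess-alternate : ∀ k → excess (moment K) k ≡ excess (alternate λ j → ‖ power K j 𝟏 ‖²) k
  excess-alternate = excessFrom-cong moment-alternate 0

  0≤‖aK²f+bf‖² : ∀ a b f → 0ℤ ≤ a * a * ‖ power K 2 f ‖² - + 2 * a * b * ‖ power K 1 f ‖² + b * b * ‖ f ‖²
  0≤‖aK²f+bf‖² a b f = subst (0ℤ ≤_) expand (0≤‖‖² (λ x → a * power K 2 f x + b * f x))
    where
    open ≡-Reasoning
    p q r : ℤ
    p = ‖ f ‖²
    q = ‖ power K 1 f ‖²
    r = ‖ power K 2 f ‖²
    regroup : ∀ x a b m → x + + 2 * a * b * - m ≡ x - + 2 * a * b * m
    regroup = solve-∀
    expand : ‖ (λ x → a * power K 2 f x + b * f x) ‖² ≡ a * a * r - + 2 * a * b * q + b * b * p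
    expand = begin
      ‖ (λ x → a * power K 2 f x + b * f x) ‖²
        ≡⟨ ‖af+bg‖² a b (power K 2 f) f ⟩
      a * a * r + + 2 * a * b * ⟨ power K 2 f , f ⟩ + b * b * p
        ≡⟨ cong (λ m → a * a * r + + 2 * a * b * m + b * b * p)
                (trans (⟨⟩-comm (power K 2 f) f) (⟨f,Kᵏf⟩-alternate f 2)) ⟩
      a * a * r + + 2 * a * b * - q + b * b * p
        ≡⟨ cong (_+ b * b * p) (regroup (a * a * r) a b q) ⟩
      a * a * r - + 2 * a * b * q + b * b * p ∎

deficit₄ : (n p : ℤ) → ℤ
deficit₄ n p = + 4 * n * p

excess₄ : ∀ e → excess (alternate e) 3 ≡ e 0 ^ 4 - deficit₄ (e 0) (e 1)
excess₄ e = solve 2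
  (λ n p → Expansion.excess _:+_ _:*_ (Alternation.alternate :-_ (con 0ℤ) λ { 0 → n ; _ → p }) 3
           := n :^ 4 :- con (+ 4) :* n :* p)
  refl (e 0) (e 1)
  where open +-*-Solver

deficit₈ : (n p q r : ℤ) → ℤ
deficit₈ n p q r = + 8 * n ^ 5 * p - + 8 * n ^ 3 * q - + 12 * n ^ 2 * (p * p) + + 8 * n * r + + 8 * (p * q)

deficit₈ᵖ : ∀ {m} (n p q r : +-*-Solver.Polynomial m) → +-*-Solver.Polynomial m
deficit₈ᵖ n p q r = con (+ 8) :* n :^ 5 :* p :- con (+ 8) :* n :^ 3 :* q :- con (+ 12) :* n :^ 2 :* (p :* p)
                    :+ con (+ 8) :* n :* r :+ con (+ 8) :* (p :* q)
  where open +-*-Solver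

excess₈ : ∀ e → excess (alternate e) 7 ≡ e 0 ^ 8 - deficit₈ (e 0) (e 1) (e 2) (e 3)
excess₈ e = solve 4
  (λ n p q r →
    Expansion.excess _:+_ _:*_ (Alternation.alternate :-_ (con 0ℤ) λ { 0 → n ; 1 → p ; 2 → q ; _ → r }) 7
    := n :^ 8 :- deficit₈ᵖ n p q r)
  refl (e 0) (e 1) (e 2) (e 3)
  where open +-*-Solver

0≤deficit₄ : ∀ {n p} → 0ℤ ≤ n → 0ℤ ≤ p → 0ℤ ≤ deficit₄ n p
0≤deficit₄ 0≤n 0≤p = 0≤i*j (0≤i*j {+ 4} (ℤ.+≤+ ℕ.z≤n) 0≤n) 0≤p

-- Twice the deficit is 4n|2K³u + n²Ku|² + p(|4K²u + 3n²u|² + 3n⁵), where p, q, r are |Ku|², |K²u|², |K³u|².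
0≤deficit₈ : ∀ {n p q r} → 0ℤ ≤ n → 0ℤ ≤ p →
  0ℤ ≤ + 2 * + 2 * r - + 2 * + 2 * n ^ 2 * q + n ^ 2 * n ^ 2 * p →
  0ℤ ≤ + 4 * + 4 * q - + 2 * + 4 * (+ 3 * n ^ 2) * p + + 3 * n ^ 2 * (+ 3 * n ^ 2) * n →
  0ℤ ≤ deficit₈ n p q r
0≤deficit₈ {n} {p} {q} {r} 0≤n 0≤p 0≤f² 0≤g² =
  ℤ.*-cancelˡ-≤-pos 0ℤ (deficit₈ n p q r) (+ 2) (subst (0ℤ ≤_) (sumOfSquares n p q r) (ℤ.+-mono-≤
    (0≤i*j (0≤i*j {+ 4} (ℤ.+≤+ ℕ.z≤n) 0≤n) 0≤f²)
    (0≤i*j 0≤p (ℤ.+-mono-≤ 0≤g² (0≤i*j (0≤i*j {+ 3} (ℤ.+≤+ ℕ.z≤n) 0≤n) (0≤i*j 0≤n² 0≤n²))))))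
  where
  open +-*-Solver
  0≤n² : 0ℤ ≤ n * n
  0≤n² = 0≤i*j 0≤n 0≤n
  sumOfSquares : ∀ n p q r →
    + 4 * n * (+ 2 * + 2 * r - + 2 * + 2 * n ^ 2 * q + n ^ 2 * n ^ 2 * p)
      + p * (+ 4 * + 4 * q - + 2 * + 4 * (+ 3 * n ^ 2) * p + + 3 * n ^ 2 * (+ 3 * n ^ 2) * n
             + + 3 * n * (n * n * (n * n)))
    ≡ + 2 * deficit₈ n p q r
  sumOfSquares = solve 4 (λ n p q r →
    con (+ 4) :* n :* (con (+ 2) :* con (+ 2) :* r :- con (+ 2) :* con (+ 2) :* n :^ 2 :* q :+ n :^ 2 :* n :^ 2 :* p)
      :+ p :* (con (+ 4) :* con (+ 4) :* q :- con (+ 2) :* con (+ 4) :* (con (+ 3) :* n :^ 2) :* p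
               :+ con (+ 3) :* n :^ 2 :* (con (+ 3) :* n :^ 2) :* n :+ con (+ 3) :* n :* (n :* n :* (n :* n)))
    := con (+ 2) :* deficit₈ᵖ n p q r) refl

deficit₄-≤ : ∀ n {p} → p ≤ + n → deficit₄ (+ n) p ≤ + 4 * (+ n) ^ 3
deficit₄-≤ n {p} p≤n = begin
  + 4 * + n * p       ≤⟨ *-mono-≤ (0≤i*j {+ 4} {+ n} (ℤ.+≤+ ℕ.z≤n) (ℤ.+≤+ ℕ.z≤n)) (ℤ.+≤+ ℕ.z≤n) ℤ.≤-refl p≤n ⟩
  + 4 * + n * + n     ≡⟨ solve 1 (λ n → con (+ 4) :* n :* n := con (+ 4) :* n :^ 2) refl (+ n) ⟩
  + 4 * (+ n) ^ 2     ≤⟨ ℤ.*-monoˡ-≤-nonNeg (+ 4) (^-monoʳ-≤ n (ℕ.n≤1+n 1)) ⟩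
  + 4 * (+ n) ^ 3     ∎
  where
  open ℤ.≤-Reasoning
  open +-*-Solver

deficit₈-≤ : ∀ n {p q r} → 0ℤ ≤ p → 0ℤ ≤ q → p ≤ + n → q ≤ (+ n) ^ 3 → r ≤ (+ n) ^ 5 →
  deficit₈ (+ n) p q r ≤ + 24 * (+ n) ^ 7
deficit₈-≤ n {p} {q} {r} 0≤p 0≤q p≤n q≤n³ r≤n⁵ = begin
  deficit₈ N p q r
    ≡⟨ regroup N p q r ⟩
  + 8 * N ^ 5 * p + + 8 * N * r + + 8 * (p * q) - (+ 8 * N ^ 3 * q + + 12 * N ^ 2 * (p * p))
    ≤⟨ ℤ.i-j≤i _ _ {{ℤ.nonNegative (ℤ.+-mono-≤ (0≤i*j (0≤c*n^k 8 3) 0≤q) (0≤i*j (0≤c*n^k 12 2) (0≤i*j 0≤p 0≤p)))}} ⟩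
  + 8 * N ^ 5 * p + + 8 * N * r + + 8 * (p * q)
    ≤⟨ ℤ.+-mono-≤ (ℤ.+-mono-≤
         (ℤ.*-monoˡ-≤-nonNeg (+ 8 * N ^ 5) {{ℤ.nonNegative (0≤c*n^k 8 5)}} p≤n)
         (ℤ.*-monoˡ-≤-nonNeg (+ 8 * N) {{ℤ.nonNegative (0≤i*j {+ 8} {N} (ℤ.+≤+ ℕ.z≤n) (ℤ.+≤+ ℕ.z≤n))}} r≤n⁵))
         (ℤ.*-monoˡ-≤-nonNeg (+ 8) (*-mono-≤ 0≤p (0≤+n^k n 3) p≤n q≤n³)) ⟩
  + 8 * N ^ 5 * N + + 8 * N * N ^ 5 + + 8 * (N * N ^ 3)
    ≡⟨ solve 1 (λ n → con (+ 8) :* n :^ 5 :* n :+ con (+ 8) :* n :* n :^ 5 :+ con (+ 8) :* (n :* n :^ 3)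
                      := con (+ 16) :* n :^ 6 :+ con (+ 8) :* n :^ 4) refl N ⟩
  + 16 * N ^ 6 + + 8 * N ^ 4
    ≤⟨ ℤ.+-mono-≤ (ℤ.*-monoˡ-≤-nonNeg (+ 16) (^-monoʳ-≤ n (ℕ.n≤1+n 5)))
                  (ℤ.*-monoˡ-≤-nonNeg (+ 8) (^-monoʳ-≤ n (ℕ.m≤m+n 3 3))) ⟩
  + 16 * N ^ 7 + + 8 * N ^ 7
    ≡⟨ ℤ.*-distribʳ-+ (N ^ 7) (+ 16) (+ 8) ⟨
  + 24 * N ^ 7 ∎
  where
  open ℤ.≤-Reasoning
  open +-*-Solver
  N : ℤ
  N = + n
  0≤c*n^k : ∀ c k → 0ℤ ≤ + c * N ^ k
  0≤c*n^k c k = 0≤i*j {+ c} (ℤ.+≤+ ℕ.z≤n) (0≤+n^k n k)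
  regroup : ∀ n p q r → deficit₈ n p q r
    ≡ + 8 * n ^ 5 * p + + 8 * n * r + + 8 * (p * q) - (+ 8 * n ^ 3 * q + + 12 * n ^ 2 * (p * p))
  regroup = solve 4 (λ n p q r → deficit₈ᵖ n p q r
    := con (+ 8) :* n :^ 5 :* p :+ con (+ 8) :* n :* r :+ con (+ 8) :* (p :* q)
       :- (con (+ 8) :* n :^ 3 :* q :+ con (+ 12) :* n :^ 2 :* (p :* p))) refl

‖𝟏‖²≡n : ∀ n → ‖ 𝟏 {n} ‖² ≡ + n
‖𝟏‖²≡n n = trans (∑-allFin-const n 1ℤ) (ℤ.*-identityʳ (+ n))

‖‖²-≤ : ∀ (f : Vector n) {c} → (∀ x → ∣ f x ∣ ℕ.≤ c) → ‖ f ‖² ≤ + (n ℕ.* (c ℕ.* c))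
‖‖²-≤ {n} f {c} ∣f∣≤c = begin
  ‖ f ‖²                                       ≡⟨ ∑-cong (allFin n) (λ x → i*i≡∣i∣*∣i∣ (f x)) ⟩
  (∑[ x ∈ allFin n ] + (∣ f x ∣ ℕ.* ∣ f x ∣))  ≤⟨ ∑-mono (allFin n) (λ x → ℤ.+≤+ (ℕ.*-mono-≤ (∣f∣≤c x) (∣f∣≤c x))) ⟩
  (∑[ x ∈ allFin n ] + (c ℕ.* c))              ≡⟨ ∑-allFin-const n (+ (c ℕ.* c)) ⟩
  + n * + (c ℕ.* c)                            ≡⟨ ℤ.pos-* n (c ℕ.* c) ⟨
  + (n ℕ.* (c ℕ.* c))                          ∎
  where open ℤ.≤-Reasoning

module _ {n : ℕ} (K : Matrix n) (∣K∣≤1 : ∀ x y → ∣ K x y ∣ ℕ.≤ 1) where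

  ∣·∣-≤ : ∀ {f c} → (∀ x → ∣ f x ∣ ℕ.≤ c) → ∀ x → ∣ (K · f) x ∣ ℕ.≤ n ℕ.* c
  ∣·∣-≤ {f} {c} ∣f∣≤c x = subst (λ m → ∣ (K · f) x ∣ ℕ.≤ m ℕ.* c) (length-allFin n) (∣∑∣-≤ (allFin n) λ y → begin
    ∣ K x y * f y ∣          ≡⟨ ℤ.abs-* (K x y) (f y) ⟩
    ∣ K x y ∣ ℕ.* ∣ f y ∣    ≤⟨ ℕ.*-mono-≤ (∣K∣≤1 x y) (∣f∣≤c y) ⟩
    1 ℕ.* c                  ≡⟨ ℕ.*-identityˡ c ⟩
    c                        ∎)
    where open ℕ.≤-Reasoning

  ∣power∣-≤ : ∀ k {f c} → (∀ x → ∣ f x ∣ ℕ.≤ c) → ∀ x → ∣ power K k f x ∣ ℕ.≤ n ℕ.^ k ℕ.* c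
  ∣power∣-≤ zero    {f} {c} ∣f∣≤c x = subst (∣ f x ∣ ℕ.≤_) (sym (ℕ.*-identityˡ c)) (∣f∣≤c x)
  ∣power∣-≤ (suc k) {f} {c} ∣f∣≤c x =
    subst (∣ power K (suc k) f x ∣ ℕ.≤_) (sym (ℕ.*-assoc n (n ℕ.^ k) c)) (∣·∣-≤ (∣power∣-≤ k ∣f∣≤c) x)

  ‖power‖²-≤ : (∀ x → ∣ (K · 𝟏) x ∣ ℕ.≤ 1) → ∀ k → ‖ power K (suc k) 𝟏 ‖² ≤ (+ n) ^ suc (k ℕ.+ k)
  ‖power‖²-≤ ∣K𝟏∣≤1 k = begin
    ‖ power K (suc k) 𝟏 ‖²                             ≡⟨ ‖‖²-cong (power-· K k 𝟏) ⟨
    ‖ power K k (K · 𝟏) ‖²                             ≤⟨ ‖‖²-≤ (power K k (K · 𝟏)) (∣power∣-≤ k ∣K𝟏∣≤1) ⟩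
    + (n ℕ.* (n ℕ.^ k ℕ.* 1 ℕ.* (n ℕ.^ k ℕ.* 1)))      ≡⟨ cong (λ m → + (n ℕ.* (m ℕ.* m))) (ℕ.*-identityʳ (n ℕ.^ k)) ⟩
    + (n ℕ.* (n ℕ.^ k ℕ.* n ℕ.^ k))                    ≡⟨ cong (λ m → + (n ℕ.* m)) (ℕ.^-distribˡ-+-* n k k) ⟨
    + (n ℕ.^ suc (k ℕ.+ k))                            ≡⟨ pos-^ n (suc (k ℕ.+ k)) ⟩
    (+ n) ^ suc (k ℕ.+ k)                              ∎
    where open ℤ.≤-Reasoning

module _ {n : ℕ} (K : Matrix n) (skew : Skew K) where

  private
    e : ℕ → ℤ
    e k = ‖ power K k 𝟏 ‖²

    0≤e : ∀ k → 0ℤ ≤ e k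
    0≤e k = 0≤‖‖² (power K k 𝟏)

  excess-moment₄ : excess (moment K) 3 ≡ (+ n) ^ 4 - deficit₄ (e 0) (e 1)
  excess-moment₄ = trans (excess-alternate K skew 3)
    (trans (excess₄ e) (cong (λ m → m ^ 4 - deficit₄ (e 0) (e 1)) (‖𝟏‖²≡n n)))

  excess-moment₈ : excess (moment K) 7 ≡ (+ n) ^ 8 - deficit₈ (e 0) (e 1) (e 2) (e 3)
  excess-moment₈ = trans (excess-alternate K skew 7)
    (trans (excess₈ e) (cong (λ m → m ^ 8 - deficit₈ (e 0) (e 1) (e 2) (e 3)) (‖𝟏‖²≡n n)))

  excess-moment₄-≤ : excess (moment K) 3 ≤ (+ n) ^ 4
  excess-moment₄-≤ = subst (_≤ (+ n) ^ 4) (sym excess-moment₄)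
    (ℤ.i-j≤i ((+ n) ^ 4) _ {{ℤ.nonNegative (0≤deficit₄ (0≤e 0) (0≤e 1))}})

  excess-moment₈-≤ : excess (moment K) 7 ≤ (+ n) ^ 8
  excess-moment₈-≤ = subst (_≤ (+ n) ^ 8) (sym excess-moment₈)
    (ℤ.i-j≤i ((+ n) ^ 8) _ {{ℤ.nonNegative (0≤deficit₈ (0≤e 0) (0≤e 1)
      (0≤‖aK²f+bf‖² K skew (+ 2) (e 0 ^ 2) (K · 𝟏)) (0≤‖aK²f+bf‖² K skew (+ 4) (+ 3 * e 0 ^ 2) 𝟏))}})

  module _ (∣K∣≤1 : ∀ x y → ∣ K x y ∣ ℕ.≤ 1) (∣K𝟏∣≤1 : ∀ x → ∣ (K · 𝟏) x ∣ ℕ.≤ 1) where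

    private
      e₁≤n : e 1 ≤ + n
      e₁≤n = subst (e 1 ≤_) (ℤ.*-identityʳ (+ n)) (‖power‖²-≤ K ∣K∣≤1 ∣K𝟏∣≤1 0)

      i≤i-j+k : ∀ {i j k} → j ≤ k → i ≤ (i - j) + k
      i≤i-j+k {i} {j} {k} j≤k = subst (_≤ (i - j) + k) (cancel i j) (ℤ.+-monoʳ-≤ (i - j) j≤k)
        where
        cancel : ∀ i j → (i - j) + j ≡ i
        cancel = solve-∀

    excess-moment₄-≥ : (+ n) ^ 4 ≤ excess (moment K) 3 + + 4 * (+ n) ^ 3
    excess-moment₄-≥ = subst (λ x → (+ n) ^ 4 ≤ x + + 4 * (+ n) ^ 3) (sym excess-moment₄) (i≤i-j+k
      (subst (λ m → deficit₄ m (e 1) ≤ + 4 * (+ n) ^ 3) (sym (‖𝟏‖²≡n n)) (deficit₄-≤ n e₁≤n)))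

    excess-moment₈-≥ : (+ n) ^ 8 ≤ excess (moment K) 7 + + 24 * (+ n) ^ 7
    excess-moment₈-≥ = subst (λ x → (+ n) ^ 8 ≤ x + + 24 * (+ n) ^ 7) (sym excess-moment₈) (i≤i-j+k
      (subst (λ m → deficit₈ m (e 1) (e 2) (e 3) ≤ + 24 * (+ n) ^ 7) (sym (‖𝟏‖²≡n n))
        (deficit₈-≤ n (0≤e 1) (0≤e 2) e₁≤n (‖power‖²-≤ K ∣K∣≤1 ∣K𝟏∣≤1 1) (‖power‖²-≤ K ∣K∣≤1 ∣K𝟏∣≤1 2))))

-- Signed Hamiltonian paths

AllPairs-resp-↭ : ∀ {R : A → A → Set} → Symmetric R → ∀ {xs ys} → xs ↭ ys → AllPairs R xs → AllPairs R ys
AllPairs-resp-↭ {R = R} R-sym p = ↭ₛ.AllPairs-resp-↭ (setoid _) R-sym (resp₂ R) (↭.↭⇒↭ₛ p)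

module Arcs {A : Set} (t : A → A → Bool) where

  infix 4 _⟶_ _⇄_
  _⟶_ : A → A → Set
  x ⟶ y = t x y ≡ true

  _⇄_ : A → A → Set
  x ⇄ y = t y x ≡ not (t x y)

  ⇄-sym : Symmetric _⇄_
  ⇄-sym {x} {y} eq = trans (sym (not-involutive (t x y))) (cong not (sym eq))

  insert : A → List A → List A
  insert x []       = x ∷ []
  insert x (y ∷ ys) = if t x y then x ∷ y ∷ ys else y ∷ insert x ys

  insert-↭ : ∀ x ys → insert x ys ↭ x ∷ ys
  insert-↭ x []       = ↭-refl
  insert-↭ x (y ∷ ys) with t x y
  ... | true  = ↭-refl
  ... | false = ↭-trans (↭-prep y (insert-↭ x ys)) (↭-swap y x ↭-refl)

  insert-linked-after : ∀ {x y ys} → All (x ⇄_) ys → y ⟶ x → Linked _⟶_ (y ∷ ys) → Linked _⟶_ (y ∷ insert x ys)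
  insert-linked-after {ys = []}        _          y⟶x _              = y⟶x ∷ [-]
  insert-linked-after {x} {ys = z ∷ _} (x⇄z ∷ x⇄) y⟶x (y⟶z ∷ linked) with t x z in x⟶z
  ... | true  = y⟶x ∷ x⟶z ∷ linked
  ... | false = y⟶z ∷ insert-linked-after x⇄ x⇄z linked

  insert-linked : ∀ {x ys} → All (x ⇄_) ys → Linked _⟶_ ys → Linked _⟶_ (insert x ys)
  insert-linked             []         _      = [-]
  insert-linked {x} {y ∷ _} (x⇄y ∷ x⇄) linked with t x y in x⟶y
  ... | true  = x⟶y ∷ linked
  ... | false = insert-linked-after x⇄ x⇄y linked

  hamiltonianPath : ∀ {xs} → AllPairs _⇄_ xs → ∃ λ ys → ys ↭ xs × Linked _⟶_ ys
  hamiltonianPath         []         = [] , ↭-refl , []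
  hamiltonianPath {x ∷ _} (x⇄ ∷ xs⇄) with hamiltonianPath xs⇄
  ... | ys , ys↭xs , linked =
    insert x ys , ↭-trans (insert-↭ x ys) (↭-prep x ys↭xs) , insert-linked (↭.All-resp-↭ (↭-sym ys↭xs) x⇄) linked

pathSign : (A → A → Bool) → List A → ℤ
pathSign t (x ∷ xs@(y ∷ _)) = sign (t x y) * pathSign t xs
pathSign t _                = 1ℤ

signedPaths : (A → A → Bool) → List A → ℤ
signedPaths t xs = ∑ (permutations xs) (pathSign t)

pathSign-map : ∀ (t : B → B → Bool) (f : A → B) xs → pathSign t (map f xs) ≡ pathSign (λ x y → t (f x) (f y)) xs
pathSign-map t f []           = refl
pathSign-map t f (x ∷ [])     = refl
pathSign-map t f (x ∷ y ∷ ys) = cong (sign (t (f x) (f y)) *_) (pathSign-map t f (y ∷ ys))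

signedPaths-map : ∀ (t : B → B → Bool) (f : A → B) xs →
  signedPaths t (map f xs) ≡ signedPaths (λ x y → t (f x) (f y)) xs
signedPaths-map t f xs = begin
  ∑ (permutations (map f xs)) (pathSign t)              ≡⟨ cong (λ yss → ∑ yss (pathSign t)) (permutations-map f xs) ⟩
  ∑ (map (map f) (permutations xs)) (pathSign t)        ≡⟨ ∑-map (map f) (permutations xs) (pathSign t) ⟩
  (∑[ ys ∈ permutations xs ] pathSign t (map f ys))     ≡⟨ ∑-cong (permutations xs) (pathSign-map t f) ⟩
  signedPaths (λ x y → t (f x) (f y)) xs                ∎
  where open ≡-Reasoning

-- Polynomials in variables with values ±1, so that every variable squares to 1; a variable that is not
-- listed stands for 1.
module SignPolynomials {V : Set} (_≟_ : DecidableEquality V) where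

  infixr 5 _+X_
  data SignPoly : List V → Set where
    0ᵖ   : ∀ {vs} → SignPoly vs
    con  : ℤ → SignPoly []
    _+X_ : ∀ {v vs} → SignPoly vs → SignPoly vs → SignPoly (v ∷ vs)

  private variable
    vs : List V

  ⟦_⟧ : SignPoly vs → (V → Bool) → ℤ
  ⟦ 0ᵖ ⟧               ρ = 0ℤ
  ⟦ con c ⟧            ρ = c
  ⟦ _+X_ {v = v} p q ⟧ ρ = ⟦ p ⟧ ρ + sign (ρ v) * ⟦ q ⟧ ρ

  1ᵖ : SignPoly vs
  1ᵖ {[]}    = con 1ℤ
  1ᵖ {_ ∷ _} = 1ᵖ +X 0ᵖ

  infixl 6 _⊕_
  _⊕_ : SignPoly vs → SignPoly vs → SignPoly vs
  0ᵖ       ⊕ q          = q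
  p        ⊕ 0ᵖ         = p
  con c    ⊕ con d      = con (c + d)
  (p +X q) ⊕ (p′ +X q′) = (p ⊕ p′) +X (q ⊕ q′)

  infixr 7 ⊝_
  ⊝_ : SignPoly vs → SignPoly vs
  ⊝ 0ᵖ       = 0ᵖ
  ⊝ con c    = con (- c)
  ⊝ (p +X q) = ⊝ p +X ⊝ q

  ∑ᵖ : List A → (A → SignPoly vs) → SignPoly vs
  ∑ᵖ []       f = 0ᵖ
  ∑ᵖ (x ∷ xs) f = f x ⊕ ∑ᵖ xs f

  infixr 7 X[_]·_
  X[_]·_ : V → SignPoly vs → SignPoly vs
  X[ u ]· 0ᵖ    = 0ᵖ
  X[ u ]· con c = con c
  X[ u ]· _+X_ {v = v} p q with u ≟ v
  ... | yes _ = q +X p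
  ... | no  _ = X[ u ]· p +X X[ u ]· q

  minimum : SignPoly vs → ℤ
  minimum         0ᵖ       = 0ℤ
  minimum {[]}    (con c)  = c
  minimum {_ ∷ _} (p +X q) = minimum (p ⊕ q) ⊓ minimum (p ⊕ ⊝ q)

  module _ (ρ : V → Bool) where

    ⟦1ᵖ⟧ : ∀ vs → ⟦ 1ᵖ {vs} ⟧ ρ ≡ 1ℤ
    ⟦1ᵖ⟧ []       = refl
    ⟦1ᵖ⟧ (v ∷ vs) = cong₂ _+_ (⟦1ᵖ⟧ vs) (ℤ.*-zeroʳ (sign (ρ v)))

    ⟦⊕⟧ : (p q : SignPoly vs) → ⟦ p ⊕ q ⟧ ρ ≡ ⟦ p ⟧ ρ + ⟦ q ⟧ ρ
    ⟦⊕⟧ 0ᵖ       q       = sym (ℤ.+-identityˡ (⟦ q ⟧ ρ))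
    ⟦⊕⟧ (con c)  0ᵖ      = sym (ℤ.+-identityʳ c)
    ⟦⊕⟧ (p +X q) 0ᵖ      = sym (ℤ.+-identityʳ _)
    ⟦⊕⟧ (con c)  (con d) = refl
    ⟦⊕⟧ (_+X_ {v = v} p q) (p′ +X q′) =
      trans (cong₂ (λ a b → a + sign (ρ v) * b) (⟦⊕⟧ p p′) (⟦⊕⟧ q q′))
            (regroup (⟦ p ⟧ ρ) (⟦ p′ ⟧ ρ) (sign (ρ v)) (⟦ q ⟧ ρ) (⟦ q′ ⟧ ρ))
      where
      regroup : ∀ a a′ s b b′ → (a + a′) + s * (b + b′) ≡ (a + s * b) + (a′ + s * b′)
      regroup = solve-∀

    ⟦⊝⟧ : (p : SignPoly vs) → ⟦ ⊝ p ⟧ ρ ≡ - ⟦ p ⟧ ρ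
    ⟦⊝⟧ 0ᵖ                 = refl
    ⟦⊝⟧ (con c)            = refl
    ⟦⊝⟧ (_+X_ {v = v} p q) =
      trans (cong₂ (λ a b → a + sign (ρ v) * b) (⟦⊝⟧ p) (⟦⊝⟧ q)) (regroup (⟦ p ⟧ ρ) (sign (ρ v)) (⟦ q ⟧ ρ))
      where
      regroup : ∀ a s b → - a + s * - b ≡ - (a + s * b)
      regroup = solve-∀

    ⟦∑ᵖ⟧ : ∀ xs (f : A → SignPoly vs) → ⟦ ∑ᵖ xs f ⟧ ρ ≡ (∑[ x ∈ xs ] ⟦ f x ⟧ ρ)
    ⟦∑ᵖ⟧ []       f = refl
    ⟦∑ᵖ⟧ (x ∷ xs) f = trans (⟦⊕⟧ (f x) (∑ᵖ xs f)) (cong (λ s → ⟦ f x ⟧ ρ + s) (⟦∑ᵖ⟧ xs f))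

    ⟦X·⟧ : ∀ u (p : SignPoly vs) → u ∈ vs ⊎ ρ u ≡ true → ⟦ X[ u ]· p ⟧ ρ ≡ sign (ρ u) * ⟦ p ⟧ ρ
    ⟦X·⟧ u 0ᵖ      _         = sym (ℤ.*-zeroʳ (sign (ρ u)))
    ⟦X·⟧ u (con c) (inj₂ ρu) = sym (trans (cong (λ b → sign b * c) ρu) (ℤ.*-identityˡ c))
    ⟦X·⟧ u (_+X_ {v = v} {vs} p q) listed with u ≟ v
    ... | yes refl = begin
      ⟦ q ⟧ ρ + s * ⟦ p ⟧ ρ             ≡⟨ cong (_+ s * ⟦ p ⟧ ρ) (ℤ.*-identityˡ (⟦ q ⟧ ρ)) ⟨
      1ℤ * ⟦ q ⟧ ρ + s * ⟦ p ⟧ ρ        ≡⟨ cong (λ a → a * ⟦ q ⟧ ρ + s * ⟦ p ⟧ ρ) (sign*sign≡1 (ρ u)) ⟨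
      s * s * ⟦ q ⟧ ρ + s * ⟦ p ⟧ ρ     ≡⟨ distrib s (⟦ p ⟧ ρ) (⟦ q ⟧ ρ) ⟩
      s * (⟦ p ⟧ ρ + s * ⟦ q ⟧ ρ)       ∎
      where
      open ≡-Reasoning
      s : ℤ
      s = sign (ρ u)
      distrib : ∀ s a b → s * s * b + s * a ≡ s * (a + s * b)
      distrib = solve-∀
    ... | no u≢v = trans (cong₂ (λ a b → a + sign (ρ v) * b) (⟦X·⟧ u p (tail listed)) (⟦X·⟧ u q (tail listed)))
                         (distrib (sign (ρ u)) (⟦ p ⟧ ρ) (sign (ρ v)) (⟦ q ⟧ ρ))
      where
      tail : u ∈ v ∷ vs ⊎ ρ u ≡ true → u ∈ vs ⊎ ρ u ≡ true
      tail (inj₁ (here u≡v))   = contradiction u≡v u≢v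
      tail (inj₁ (there u∈vs)) = inj₁ u∈vs
      tail (inj₂ ρu)           = inj₂ ρu
      distrib : ∀ s a v b → s * a + v * (s * b) ≡ s * (a + v * b)
      distrib = solve-∀

    minimum-≤ : (p : SignPoly vs) → minimum p ≤ ⟦ p ⟧ ρ
    minimum-≤         0ᵖ       = ℤ.≤-refl
    minimum-≤ {[]}    (con c)  = ℤ.≤-refl
    minimum-≤ {v ∷ _} (p +X q) with ρ v
    ... | true  = begin
      minimum (p ⊕ q) ⊓ minimum (p ⊕ ⊝ q)     ≤⟨ ℤ.i⊓j≤i (minimum (p ⊕ q)) _ ⟩
      minimum (p ⊕ q)                         ≤⟨ minimum-≤ (p ⊕ q) ⟩
      ⟦ p ⊕ q ⟧ ρ                             ≡⟨ ⟦⊕⟧ p q ⟩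
      ⟦ p ⟧ ρ + ⟦ q ⟧ ρ                       ≡⟨ cong (λ s → ⟦ p ⟧ ρ + s) (ℤ.*-identityˡ (⟦ q ⟧ ρ)) ⟨
      ⟦ p ⟧ ρ + 1ℤ * ⟦ q ⟧ ρ                  ∎
      where open ℤ.≤-Reasoning
    ... | false = begin
      minimum (p ⊕ q) ⊓ minimum (p ⊕ ⊝ q)     ≤⟨ ℤ.i⊓j≤j (minimum (p ⊕ q)) _ ⟩
      minimum (p ⊕ ⊝ q)                       ≤⟨ minimum-≤ (p ⊕ ⊝ q) ⟩
      ⟦ p ⊕ ⊝ q ⟧ ρ                           ≡⟨ trans (⟦⊕⟧ p (⊝ q)) (cong (λ s → ⟦ p ⟧ ρ + s) (⟦⊝⟧ q)) ⟩
      ⟦ p ⟧ ρ - ⟦ q ⟧ ρ                       ≡⟨ cong (λ s → ⟦ p ⟧ ρ + s) (ℤ.-1*i≡-i (⟦ q ⟧ ρ)) ⟨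
      ⟦ p ⟧ ρ + - 1ℤ * ⟦ q ⟧ ρ                ∎
      where open ℤ.≤-Reasoning

    minimum-constant : (p : SignPoly []) → minimum p ≡ ⟦ p ⟧ ρ
    minimum-constant 0ᵖ      = refl
    minimum-constant (con c) = refl

module PathPolynomial (m : ℕ) where

  open SignPolynomials (≡-dec (Fin._≟_ {m}) (Fin._≟_ {m})) public

  module _ {arcs : List (Fin m × Fin m)} where

    timesArc : Fin m → Fin m → SignPoly arcs → SignPoly arcs
    timesArc i j p = if toℕ i ℕ.<ᵇ toℕ j then X[ i , j ]· p else ⊝ X[ j , i ]· p

    pathMonomial : List (Fin m) → SignPoly arcs
    pathMonomial (i ∷ is@(j ∷ _)) = timesArc i j (pathMonomial is)
    pathMonomial _                = 1ᵖ

  pathPolynomial : ∀ arcs → SignPoly arcs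
  pathPolynomial arcs = ∑ᵖ (permutations (allFin m)) pathMonomial

  module _ {arcs} (t : Fin m → Fin m → Bool) (skew : ∀ {i j} → i ≢ j → t j i ≡ not (t i j))
           (listed : ∀ {i j} → i Fin.< j → (i , j) ∈ arcs ⊎ t i j ≡ true) where

    private
      ρ : Fin m × Fin m → Bool
      ρ = uncurry t

    ⟦timesArc⟧ : ∀ {i j} → i ≢ j → (p : SignPoly arcs) → ⟦ timesArc i j p ⟧ ρ ≡ sign (t i j) * ⟦ p ⟧ ρ
    ⟦timesArc⟧ {i} {j} i≢j p with toℕ i ℕ.<ᵇ toℕ j in i<ᵇj
    ... | true  = ⟦X·⟧ ρ (i , j) p (listed (<ᵇ≡true⇒< i<ᵇj))
    ... | false = begin
      ⟦ ⊝ X[ j , i ]· p ⟧ ρ            ≡⟨ ⟦⊝⟧ ρ (X[ j , i ]· p) ⟩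
      - ⟦ X[ j , i ]· p ⟧ ρ            ≡⟨ cong -_ (⟦X·⟧ ρ (j , i) p (listed j<i)) ⟩
      - (sign (t j i) * ⟦ p ⟧ ρ)       ≡⟨ ℤ.neg-distribˡ-* (sign (t j i)) (⟦ p ⟧ ρ) ⟩
      - sign (t j i) * ⟦ p ⟧ ρ         ≡⟨ cong (_* ⟦ p ⟧ ρ) (sign-not (t j i)) ⟨
      sign (not (t j i)) * ⟦ p ⟧ ρ     ≡⟨ cong (λ b → sign b * ⟦ p ⟧ ρ) (skew (≢-sym i≢j)) ⟨
      sign (t i j) * ⟦ p ⟧ ρ           ∎
      where
      open ≡-Reasoning
      j<i : j Fin.< i
      j<i = ℕ.≤∧≢⇒< (<ᵇ≡false⇒≥ i<ᵇj) (≢-sym i≢j ∘ Fin.toℕ-injective)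

    ⟦pathMonomial⟧ : ∀ {is} → Unique is → ⟦ pathMonomial {arcs} is ⟧ ρ ≡ pathSign t is
    ⟦pathMonomial⟧              []                     = ⟦1ᵖ⟧ ρ arcs
    ⟦pathMonomial⟧ {_ ∷ []}     (_ ∷ _)                = ⟦1ᵖ⟧ ρ arcs
    ⟦pathMonomial⟧ {i ∷ j ∷ is} ((i≢j ∷ _) ∷ unique)   =
      trans (⟦timesArc⟧ i≢j (pathMonomial (j ∷ is))) (cong (sign (t i j) *_) (⟦pathMonomial⟧ unique))

    ⟦pathPolynomial⟧ : ⟦ pathPolynomial arcs ⟧ ρ ≡ signedPaths t (allFin m)
    ⟦pathPolynomial⟧ = trans (⟦∑ᵖ⟧ ρ (permutations (allFin m)) pathMonomial)
      (∑-cong-All (All.map (λ is↭ → ⟦pathMonomial⟧ (AllPairs-resp-↭ ≢-sym (↭-sym is↭) (Unique.allFin⁺ m)))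
                           (permutations-↭ (allFin m))))

  chords : List (Fin m × Fin m)
  chords = filter (λ (i , j) → suc (toℕ i) ℕ.<? toℕ j) (cartesianProduct (allFin m) (allFin m))

  ∈-chords : ∀ {i j} → suc (toℕ i) ℕ.< toℕ j → (i , j) ∈ chords
  ∈-chords {i} {j} 1+i<j = ∈-filter⁺ _ (∈-cartesianProduct⁺ (∈-allFin i) (∈-allFin j)) 1+i<j

open PathPolynomial using (pathPolynomial; chords)

-- The least value of signedPaths on {0, …, m − 1} if the given pairs are oriented arbitrarily and all the
-- other pairs i < j are oriented from i to j.
minSignedPaths : ∀ m → List (Fin m × Fin m) → ℤ
minSignedPaths m arcs = PathPolynomial.minimum m (pathPolynomial m arcs)

Linked-lookup : ∀ {R : A → A → Set} {xs} → Linked R xs →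
  ∀ {i j} → toℕ j ≡ suc (toℕ i) → R (lookup xs i) (lookup xs j)
Linked-lookup (Rxy ∷ _)    {zero}  {suc zero} _     = Rxy
Linked-lookup (_ ∷ linked) {suc i} {suc j}    j≡1+i = Linked-lookup linked (ℕ.suc-injective j≡1+i)

AllPairs-lookup-< : ∀ {R : A → A → Set} {xs} → AllPairs R xs →
  ∀ {i j} → i Fin.< j → R (lookup xs i) (lookup xs j)
AllPairs-lookup-< (Rx ∷ _)  {zero}  {suc j} _           = All.lookup Rx (∈-lookup j)
AllPairs-lookup-< (_ ∷ Rxs) {suc i} {suc j} (ℕ.s≤s i<j) = AllPairs-lookup-< Rxs i<j

AllPairs-lookup-≢ : ∀ {R : A → A → Set} {xs} → Symmetric R → AllPairs R xs →
  ∀ {i j} → i ≢ j → R (lookup xs i) (lookup xs j)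
AllPairs-lookup-≢ R-sym Rxs {i} {j} i≢j with Fin.<-cmp i j
... | tri< i<j _ _ = AllPairs-lookup-< Rxs i<j
... | tri≈ _ i≡j _ = contradiction i≡j i≢j
... | tri> _ _ j<i = R-sym (AllPairs-lookup-< Rxs j<i)

module _ {A : Set} (t : A → A → Bool) where

  open Arcs t

  signedPaths-lookup : ∀ xs →
    signedPaths (λ i j → t (lookup xs i) (lookup xs j)) (allFin (length xs)) ≡ signedPaths t xs
  signedPaths-lookup xs = begin
    signedPaths (λ i j → t (lookup xs i) (lookup xs j)) (allFin (length xs))
      ≡⟨ signedPaths-map t (lookup xs) (allFin (length xs)) ⟨
    signedPaths t (map (lookup xs) (allFin (length xs)))
      ≡⟨ cong (signedPaths t) (trans (List.map-tabulate (λ i → i) (lookup xs)) (List.tabulate-lookup xs)) ⟩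
    signedPaths t xs ∎
    where open ≡-Reasoning

  module _ {xs : List A} (xs⇄ : AllPairs _⇄_ xs) where

    private
      m : ℕ
      m = length xs

      ρ : Fin m × Fin m → Bool
      ρ (i , j) = t (lookup xs i) (lookup xs j)

    open PathPolynomial m hiding (pathPolynomial; chords)

    ⟦pathPolynomial⟧-lookup : ∀ arcs → (∀ {i j} → i Fin.< j → (i , j) ∈ arcs ⊎ lookup xs i ⟶ lookup xs j) →
      ⟦ pathPolynomial m arcs ⟧ ρ ≡ signedPaths t xs
    ⟦pathPolynomial⟧-lookup arcs listed =
      trans (⟦pathPolynomial⟧ _ (AllPairs-lookup-≢ ⇄-sym xs⇄) listed) (signedPaths-lookup xs)

    minSignedPaths-chords : Linked _⟶_ xs → minSignedPaths m (chords m) ≤ signedPaths t xs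
    minSignedPaths-chords linked = subst (minSignedPaths m (chords m) ≤_)
      (⟦pathPolynomial⟧-lookup (chords m) chordOrArc) (minimum-≤ ρ (pathPolynomial m (chords m)))
      where
      chordOrArc : ∀ {i j} → i Fin.< j → (i , j) ∈ chords m ⊎ lookup xs i ⟶ lookup xs j
      chordOrArc i<j with ℕ.m≤n⇒m<n∨m≡n i<j
      ... | inj₁ 1+i<j = inj₁ (∈-chords 1+i<j)
      ... | inj₂ 1+i≡j = inj₂ (Linked-lookup linked (sym 1+i≡j))

    minSignedPaths-[] : AllPairs _⟶_ xs → signedPaths t xs ≡ minSignedPaths m []
    minSignedPaths-[] xs⟶ = sym (trans (minimum-constant ρ (pathPolynomial m []))
      (⟦pathPolynomial⟧-lookup [] (inj₂ ∘ AllPairs-lookup-< xs⟶)))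

  signedPaths-≥ : ∀ xs → AllPairs _⇄_ xs → minSignedPaths (length xs) (chords (length xs)) ≤ signedPaths t xs
  signedPaths-≥ xs xs⇄ with hamiltonianPath xs⇄
  ... | ys , ys↭xs , linked = subst₂ (λ m s → minSignedPaths m (chords m) ≤ s)
    (↭.↭-length ys↭xs) (∑-permutations-resp-↭ (pathSign t) ys↭xs)
    (minSignedPaths-chords (AllPairs-resp-↭ ⇄-sym (↭-sym ys↭xs) xs⇄) linked)

  signedPaths-transitive : Transitive _⟶_ → ∀ xs → AllPairs _⇄_ xs → signedPaths t xs ≡ minSignedPaths (length xs) []
  signedPaths-transitive ⟶-trans xs xs⇄ with hamiltonianPath xs⇄
  ... | ys , ys↭xs , linked = subst₂ (λ s m → s ≡ minSignedPaths m [])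
    (∑-permutations-resp-↭ (pathSign t) ys↭xs) (↭.↭-length ys↭xs)
    (minSignedPaths-[] (AllPairs-resp-↭ ⇄-sym (↭-sym ys↭xs) xs⇄) (Linked⇒AllPairs ⟶-trans linked))

-- Inequalities up to O(nʲ)

module Asymptotics {I : Set} (size : I → ℕ) (j : ℕ) where

  infix 4 _≲_
  record _≲_ (f g : I → ℤ) : Set where
    constructor _,_
    field
      constant : ℕ
      bound    : ∀ i → f i ≤ g i + + constant * (+ size i) ^ j

  ≤⇒≲ : ∀ {f g} → (∀ i → f i ≤ g i) → f ≲ g
  ≤⇒≲ f≤g = 0 , λ i → ℤ.≤-trans (f≤g i) (ℤ.≤-reflexive (sym (ℤ.+-identityʳ _)))

  ≲-trans : ∀ {f g h} → f ≲ g → g ≲ h → f ≲ h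
  ≲-trans {f} {g} {h} (c , f≤) (d , g≤) = c ℕ.+ d , λ i → begin
    f i                                                              ≤⟨ f≤ i ⟩
    g i + + c * (+ size i) ^ j                                       ≤⟨ ℤ.+-monoˡ-≤ (+ c * (+ size i) ^ j) (g≤ i) ⟩
    h i + + d * (+ size i) ^ j + + c * (+ size i) ^ j                ≡⟨ collect (h i) (+ c) (+ d) ((+ size i) ^ j) ⟩
    h i + + (c ℕ.+ d) * (+ size i) ^ j                               ∎
    where
    open ℤ.≤-Reasoning
    collect : ∀ h c d p → h + d * p + c * p ≡ h + (c + d) * p
    collect = solve-∀

  +-mono-≲ : ∀ {f g f′ g′} → f ≲ g → f′ ≲ g′ → (λ i → f i + f′ i) ≲ (λ i → g i + g′ i)
  +-mono-≲ {f} {g} {f′} {g′} (c , f≤) (d , f′≤) = c ℕ.+ d , λ i → begin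
    f i + f′ i
      ≤⟨ ℤ.+-mono-≤ (f≤ i) (f′≤ i) ⟩
    g i + + c * (+ size i) ^ j + (g′ i + + d * (+ size i) ^ j)
      ≡⟨ collect (g i) (g′ i) (+ c) (+ d) ((+ size i) ^ j) ⟩
    g i + g′ i + + (c ℕ.+ d) * (+ size i) ^ j ∎
    where
    open ℤ.≤-Reasoning
    collect : ∀ g g′ c d p → g + c * p + (g′ + d * p) ≡ g + g′ + (c + d) * p
    collect = solve-∀

  *-monoˡ-≲ : ∀ k {f g} → f ≲ g → (λ i → + k * f i) ≲ (λ i → + k * g i)
  *-monoˡ-≲ k {f} {g} (c , f≤) = k ℕ.* c , λ i → begin
    + k * f i                                      ≤⟨ ℤ.*-monoˡ-≤-nonNeg (+ k) (f≤ i) ⟩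
    + k * (g i + + c * (+ size i) ^ j)             ≡⟨ distrib (+ k) (g i) (+ c) ((+ size i) ^ j) ⟩
    + k * g i + + k * + c * (+ size i) ^ j         ≡⟨ cong (λ d → + k * g i + d * (+ size i) ^ j) (ℤ.pos-* k c) ⟨
    + k * g i + + (k ℕ.* c) * (+ size i) ^ j       ∎
    where
    open ℤ.≤-Reasoning
    distrib : ∀ k g c p → k * (g + c * p) ≡ k * g + k * c * p
    distrib = solve-∀

  ≲-antisym : ∀ {f g} → f ≲ g → g ≲ f → ∃ λ c → ∀ i → ∣ f i - g i ∣ ℕ.≤ c ℕ.* size i ℕ.^ j
  ≲-antisym {f} {g} (c , f≤) (d , g≤) = c ℕ.+ d , λ i → i≤n⇒-i≤n⇒∣i∣≤n (f i - g i)
    (difference i (ℕ.m≤m+n c d) (f≤ i))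
    (subst (_≤ + ((c ℕ.+ d) ℕ.* size i ℕ.^ j)) (negate (f i) (g i)) (difference i (ℕ.m≤n+m d c) (g≤ i)))
    where
    negate : ∀ a b → b - a ≡ - (a - b)
    negate = solve-∀
    cancel : ∀ b x → b + x - b ≡ x
    cancel = solve-∀
    difference : ∀ i {a b e} → e ℕ.≤ c ℕ.+ d → a ≤ b + + e * (+ size i) ^ j →
      a - b ≤ + ((c ℕ.+ d) ℕ.* size i ℕ.^ j)
    difference i {a} {b} {e} e≤c+d a≤b+x = begin
      a - b                                   ≤⟨ ℤ.+-monoˡ-≤ (- b) a≤b+x ⟩
      b + + e * (+ size i) ^ j - b            ≡⟨ cancel b _ ⟩
      + e * (+ size i) ^ j                    ≡⟨ pos-*-^ e (size i) j ⟨
      + (e ℕ.* size i ℕ.^ j)                  ≤⟨ ℤ.+≤+ (ℕ.*-monoˡ-≤ (size i ℕ.^ j) e≤c+d) ⟩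
      + ((c ℕ.+ d) ℕ.* size i ℕ.^ j)          ∎
      where open ℤ.≤-Reasoning

  ≲-preorder : Preorder 0ℓ 0ℓ 0ℓ
  ≲-preorder = record
    { Carrier = I → ℤ
    ; _≈_     = _≗_
    ; _≲_     = _≲_
    ; isPreorder = record
      { isEquivalence = Setoid.isEquivalence (I →-setoid ℤ)
      ; reflexive     = λ f≗g → ≤⇒≲ (ℤ.≤-reflexive ∘ f≗g)
      ; trans         = ≲-trans
      }
    }

  module ≲-Reasoning = PreorderReasoning ≲-preorder

-- Sequences with repetitions

infix 4 _∈ᵇ_
_∈ᵇ_ : Fin n → List (Fin n) → Bool
x ∈ᵇ ys = any (λ y → ⌊ x Fin.≟ y ⌋) ys

∈ᵇ≡false⇒≢ : ∀ (x : Fin n) ys → (x ∈ᵇ ys) ≡ false → All (x ≢_) ys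
∈ᵇ≡false⇒≢ x []       _ = []
∈ᵇ≡false⇒≢ x (y ∷ ys) x∉ys with x Fin.≟ y
... | no x≢y = x≢y ∷ ∈ᵇ≡false⇒≢ x ys x∉ys

distinct⇒Unique : ∀ (xs : List (Fin n)) → distinct xs ≡ true → Unique xs
distinct⇒Unique []       _ = []
distinct⇒Unique (x ∷ xs) d with x ∈ᵇ xs in x∉xs
... | false = ∈ᵇ≡false⇒≢ x xs x∉xs ∷ distinct⇒Unique xs d

∑-indicator-≟ : ∀ (y : Fin n) → (∑[ x ∈ allFin n ] indicator ⌊ x Fin.≟ y ⌋) ≡ 1ℤ
∑-indicator-≟ {suc n} zero = begin
  (∑[ x ∈ allFin (suc n) ] indicator ⌊ x Fin.≟ zero ⌋)     ≡⟨ ∑-allFin-suc n (λ x → indicator ⌊ x Fin.≟ zero ⌋) ⟩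
  1ℤ + (∑[ _ ∈ allFin n ] 0ℤ)                              ≡⟨ cong (λ s → 1ℤ + s) (∑-zero (allFin n)) ⟩
  1ℤ                                                       ∎
  where open ≡-Reasoning
∑-indicator-≟ {suc n} (suc y) = begin
  (∑[ x ∈ allFin (suc n) ] indicator ⌊ x Fin.≟ suc y ⌋)        ≡⟨ ∑-allFin-suc n (λ x → indicator ⌊ x Fin.≟ suc y ⌋) ⟩
  0ℤ + (∑[ x ∈ allFin n ] indicator ⌊ suc x Fin.≟ suc y ⌋)     ≡⟨ ℤ.+-identityˡ _ ⟩
  (∑[ x ∈ allFin n ] indicator ⌊ suc x Fin.≟ suc y ⌋)          ≡⟨ ∑-cong (allFin n) suc-≟ ⟩
  (∑[ x ∈ allFin n ] indicator ⌊ x Fin.≟ y ⌋)                  ≡⟨ ∑-indicator-≟ y ⟩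
  1ℤ                                                           ∎
  where
  open ≡-Reasoning
  suc-≟ : ∀ x → indicator ⌊ suc x Fin.≟ suc y ⌋ ≡ indicator ⌊ x Fin.≟ y ⌋
  suc-≟ x with x Fin.≟ y
  ... | yes _ = refl
  ... | no  _ = refl

∑-indicator-∈ᵇ : ∀ (ys : List (Fin n)) → (∑[ x ∈ allFin n ] indicator (x ∈ᵇ ys)) ≤ + length ys
∑-indicator-∈ᵇ {n} []       = ℤ.≤-reflexive (∑-zero (allFin n))
∑-indicator-∈ᵇ {n} (y ∷ ys) = begin
  (∑[ x ∈ allFin n ] indicator (x ∈ᵇ y ∷ ys))
    ≤⟨ ∑-mono (allFin n) (λ x → indicator-∨-≤ ⌊ x Fin.≟ y ⌋ (x ∈ᵇ ys)) ⟩
  (∑[ x ∈ allFin n ] indicator ⌊ x Fin.≟ y ⌋ + indicator (x ∈ᵇ ys))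
    ≡⟨ ∑-distrib-+ (allFin n) _ _ ⟩
  (∑[ x ∈ allFin n ] indicator ⌊ x Fin.≟ y ⌋) + (∑[ x ∈ allFin n ] indicator (x ∈ᵇ ys))
    ≤⟨ ℤ.+-mono-≤ (ℤ.≤-reflexive (∑-indicator-≟ y)) (∑-indicator-∈ᵇ ys) ⟩
  + suc (length ys) ∎
  where open ℤ.≤-Reasoning

triangular : ℕ → ℕ
triangular zero    = 0
triangular (suc k) = k ℕ.+ triangular k

repeats : List (Fin n) → ℤ
repeats xs = indicator (not (distinct xs))

repeats-∷ : ∀ (x : Fin n) xs → repeats (x ∷ xs) ≤ indicator (x ∈ᵇ xs) + repeats xs
repeats-∷ x xs = subst (λ b → indicator b ≤ indicator (x ∈ᵇ xs) + repeats xs)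
  (sym (deMorgan (x ∈ᵇ xs))) (indicator-∨-≤ (x ∈ᵇ xs) (not (distinct xs)))
  where
  deMorgan : ∀ a → not (not a ∧ distinct xs) ≡ a ∨ not (distinct xs)
  deMorgan true  = refl
  deMorgan false = refl

∑-repeats : ∀ n k → ∑ (allSeqs n (suc k)) repeats ≤ + triangular (suc k) * (+ n) ^ k
∑-repeats n zero    = ℤ.≤-reflexive (trans (∑-allSeqs-suc n 0 repeats) (∑-zero (allFin n)))
∑-repeats n (suc k) = begin
  ∑ (allSeqs n (suc (suc k))) repeats
    ≡⟨ ∑-allSeqs-suc n (suc k) repeats ⟩
  (∑[ x ∈ allFin n ] ∑[ xs ∈ seqs ] repeats (x ∷ xs))
    ≤⟨ ∑-mono (allFin n) (λ x → ∑-mono seqs (repeats-∷ x)) ⟩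
  (∑[ x ∈ allFin n ] ∑[ xs ∈ seqs ] indicator (x ∈ᵇ xs) + repeats xs)
    ≡⟨ trans (∑-cong (allFin n) (λ x → ∑-distrib-+ seqs _ repeats)) (∑-distrib-+ (allFin n) _ _) ⟩
  (∑[ x ∈ allFin n ] ∑[ xs ∈ seqs ] indicator (x ∈ᵇ xs)) + (∑[ _ ∈ allFin n ] ∑ seqs repeats)
    ≡⟨ cong₂ _+_ (∑-comm (allFin n) seqs _) (∑-allFin-const n (∑ seqs repeats)) ⟩
  (∑[ xs ∈ seqs ] ∑[ x ∈ allFin n ] indicator (x ∈ᵇ xs)) + + n * ∑ seqs repeats
    ≤⟨ ℤ.+-mono-≤ (∑-mono-All (All.map (λ {xs} → ∑-∈ᵇ-≤ xs) (length-allSeqs n (suc k))))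
                  (ℤ.*-monoˡ-≤-nonNeg (+ n) (∑-repeats n k)) ⟩
  (∑[ _ ∈ seqs ] + suc k) + + n * (+ triangular (suc k) * (+ n) ^ k)
    ≡⟨ cong (_+ + n * (+ triangular (suc k) * (+ n) ^ k)) (∑-allSeqs-const n (suc k) (+ suc k)) ⟩
  + n * (+ n) ^ k * + suc k + + n * (+ triangular (suc k) * (+ n) ^ k)
    ≡⟨ collect (+ n) ((+ n) ^ k) (+ suc k) (+ triangular (suc k)) ⟩
  + triangular (suc (suc k)) * (+ n) ^ suc k ∎
  where
  open ℤ.≤-Reasoning
  seqs : List (List (Fin n))
  seqs = allSeqs n (suc k)
  ∑-∈ᵇ-≤ : ∀ xs → length xs ≡ suc k → (∑[ x ∈ allFin n ] indicator (x ∈ᵇ xs)) ≤ + suc k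
  ∑-∈ᵇ-≤ xs |xs|≡1+k = subst (λ m → (∑[ x ∈ allFin n ] indicator (x ∈ᵇ xs)) ≤ + m) |xs|≡1+k (∑-indicator-∈ᵇ xs)
  collect : ∀ n p a b → n * p * a + n * (b * p) ≡ (a + b) * (n * p)
  collect = solve-∀

module _ {I : Set} (size : I → ℕ) (k : ℕ) where

  open Asymptotics size k

  ∑-mono-distinct : ∀ (F G : ∀ i → List (Fin (size i)) → ℤ) c →
    (∀ i xs → length xs ≡ suc k → distinct xs ≡ true → F i xs ≤ G i xs) →
    (∀ i xs → length xs ≡ suc k → F i xs ≤ G i xs + + c) →
    (λ i → ∑ (allSeqs (size i) (suc k)) (F i)) ≲ (λ i → ∑ (allSeqs (size i) (suc k)) (G i))
  ∑-mono-distinct F G c F≤G F≤G+c = c ℕ.* triangular (suc k) , λ i →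
    let open ℤ.≤-Reasoning; n = size i; seqs = allSeqs n (suc k) in begin
    ∑ seqs (F i)
      ≤⟨ ∑-mono-All (All.map (λ {xs} → F≤G+c*repeats i xs) (length-allSeqs n (suc k))) ⟩
    (∑[ xs ∈ seqs ] G i xs + + c * repeats xs)
      ≡⟨ ∑-distrib-+ seqs (G i) (λ xs → + c * repeats xs) ⟩
    ∑ seqs (G i) + (∑[ xs ∈ seqs ] + c * repeats xs)
      ≡⟨ cong (λ s → ∑ seqs (G i) + s) (*-distribˡ-∑ (+ c) seqs repeats) ⟨
    ∑ seqs (G i) + + c * ∑ seqs repeats
      ≤⟨ ℤ.+-monoʳ-≤ (∑ seqs (G i)) (ℤ.*-monoˡ-≤-nonNeg (+ c) (∑-repeats n k)) ⟩
    ∑ seqs (G i) + + c * (+ triangular (suc k) * (+ n) ^ k)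
      ≡⟨ cong (λ s → ∑ seqs (G i) + s) (ℤ.*-assoc (+ c) (+ triangular (suc k)) ((+ n) ^ k)) ⟨
    ∑ seqs (G i) + + c * + triangular (suc k) * (+ n) ^ k
      ≡⟨ cong (λ d → ∑ seqs (G i) + d * (+ n) ^ k) (ℤ.pos-* c (triangular (suc k))) ⟨
    ∑ seqs (G i) + + (c ℕ.* triangular (suc k)) * (+ n) ^ k ∎
    where
    F≤G+c*repeats : ∀ i xs → length xs ≡ suc k → F i xs ≤ G i xs + + c * repeats xs
    F≤G+c*repeats i xs |xs|≡1+k with distinct xs in d
    ... | true  = subst (F i xs ≤_) (sym (trans (cong (λ s → G i xs + s) (ℤ.*-zeroʳ (+ c))) (ℤ.+-identityʳ (G i xs))))
                    (F≤G i xs |xs|≡1+k d)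
    ... | false = subst (F i xs ≤_) (cong (λ s → G i xs + s) (sym (ℤ.*-identityʳ (+ c)))) (F≤G+c i xs |xs|≡1+k)

-- Closed walks and cycles

walk : (A → A → ℤ) → A → List A → A → ℤ
walk w x []       z = w x z
walk w x (y ∷ ys) z = w x y * walk w y ys z

closedWalk : (A → A → ℤ) → List A → ℤ
closedWalk w []       = 0ℤ
closedWalk w (x ∷ xs) = walk w x xs x

∑-walk : ∀ {n} (K : Matrix n) k x z → (∑[ ys ∈ allSeqs n k ] walk K x ys z) ≡ power K k (column K z) x
∑-walk         K zero    x z = ℤ.+-identityʳ (K x z)
∑-walk {n = n} K (suc k) x z = begin
  (∑[ ys ∈ allSeqs n (suc k) ] walk K x ys z)
    ≡⟨ ∑-allSeqs-suc n k (λ ys → walk K x ys z) ⟩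
  (∑[ y ∈ allFin n ] ∑[ ys ∈ allSeqs n k ] K x y * walk K y ys z)
    ≡⟨ ∑-cong (allFin n) (λ y → *-distribˡ-∑ (K x y) (allSeqs n k) _) ⟨
  (∑[ y ∈ allFin n ] K x y * (∑[ ys ∈ allSeqs n k ] walk K y ys z))
    ≡⟨ ∑-cong (allFin n) (λ y → cong (K x y *_) (∑-walk K k y z)) ⟩
  power K (suc k) (column K z) x ∎
  where open ≡-Reasoning

∑-closedWalk : ∀ {n} (K : Matrix n) k → ∑ (allSeqs n (suc k)) (closedWalk K) ≡ trace K k
∑-closedWalk {n} K k = trans (∑-allSeqs-suc n k (closedWalk K)) (∑-cong (allFin n) λ z → ∑-walk K k z z)

length-filter-≟true : ∀ (f : A → Bool) xs → + length (filter (λ x → f x Bool.≟ true) xs) ≡ ∑ xs (indicator ∘ f)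
length-filter-≟true f []       = refl
length-filter-≟true f (x ∷ xs) with f x
... | true  = cong (λ s → 1ℤ + s) (length-filter-≟true f xs)
... | false = trans (length-filter-≟true f xs) (sym (ℤ.+-identityˡ _))

adjacency : Tournament n → Matrix n
adjacency T x y = indicator (arc T x y)

signMatrix : Tournament n → Matrix n
signMatrix T x y with x Fin.≟ y
... | yes _ = 0ℤ
... | no  _ = sign (arc T x y)

module _ (T : Tournament n) where

  private
    K M : Matrix n
    K = signMatrix T
    M = J+ K

  signMatrix-≢ : ∀ {x y} → x ≢ y → K x y ≡ sign (arc T x y)
  signMatrix-≢ {x} {y} x≢y with x Fin.≟ y
  ... | yes x≡y = contradiction x≡y x≢y
  ... | no  _   = refl

  signMatrix-skew : Skew K
  signMatrix-skew x y with x Fin.≟ y | y Fin.≟ x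
  ... | yes _   | yes _   = refl
  ... | no  _   | no  y≢x = trans (cong sign (total T y x y≢x)) (sign-not (arc T x y))
  ... | yes x≡y | no  y≢x = contradiction (sym x≡y) y≢x
  ... | no  x≢y | yes y≡x = contradiction (sym y≡x) x≢y

  ∣signMatrix∣≤1 : ∀ x y → ∣ K x y ∣ ℕ.≤ 1
  ∣signMatrix∣≤1 x y with x Fin.≟ y
  ... | yes _ = ℕ.z≤n
  ... | no  _ with arc T x y
  ...   | true  = ℕ.≤-refl
  ...   | false = ℕ.≤-refl

  0≤J+K : ∀ x y → 0ℤ ≤ M x y
  0≤J+K x y with x Fin.≟ y
  ... | yes _ = ℤ.+≤+ ℕ.z≤n
  ... | no  _ with arc T x y
  ...   | true  = ℤ.+≤+ ℕ.z≤n
  ...   | false = ℤ.+≤+ ℕ.z≤n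

  J+K≤2 : ∀ x y → M x y ≤ + 2
  J+K≤2 x y with x Fin.≟ y
  ... | yes _ = ℤ.+≤+ (ℕ.s≤s ℕ.z≤n)
  ... | no  _ with arc T x y
  ...   | true  = ℤ.≤-refl
  ...   | false = ℤ.+≤+ ℕ.z≤n

  J+K-≢ : ∀ {x y} → x ≢ y → M x y ≡ + 2 * adjacency T x y
  J+K-≢ {x} {y} x≢y = trans (cong (λ k → 1ℤ + k) (signMatrix-≢ x≢y)) (1+sign (arc T x y))
    where
    1+sign : ∀ b → 1ℤ + sign b ≡ + 2 * indicator b
    1+sign true  = refl
    1+sign false = refl

  0≤walk : ∀ x ys z → 0ℤ ≤ walk M x ys z
  0≤walk x []       z = 0≤J+K x z
  0≤walk x (y ∷ ys) z = 0≤i*j (0≤J+K x y) (0≤walk y ys z)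

  walk-≤ : ∀ x ys z → walk M x ys z ≤ + (2 ℕ.^ suc (length ys))
  walk-≤ x []       z = J+K≤2 x z
  walk-≤ x (y ∷ ys) z = ℤ.≤-trans (*-mono-≤ (0≤J+K x y) (ℤ.+≤+ ℕ.z≤n) (J+K≤2 x y) (walk-≤ y ys z))
    (ℤ.≤-reflexive (sym (ℤ.pos-* 2 (2 ℕ.^ suc (length ys)))))

  walk-Linked : ∀ x ys z → Linked _≢_ (x ∷ ys ++ [ z ]) →
    walk M x ys z ≡ + (2 ℕ.^ suc (length ys)) * walk (adjacency T) x ys z
  walk-Linked x []       z (x≢z ∷ _)      = J+K-≢ x≢z
  walk-Linked x (y ∷ ys) z (x≢y ∷ linked) = begin
    M x y * walk M y ys z
      ≡⟨ cong₂ _*_ (J+K-≢ x≢y) (walk-Linked y ys z linked) ⟩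
    + 2 * adjacency T x y * (+ (2 ℕ.^ suc (length ys)) * walk (adjacency T) y ys z)
      ≡⟨ regroup (adjacency T x y) (+ (2 ℕ.^ suc (length ys))) _ ⟩
    + 2 * + (2 ℕ.^ suc (length ys)) * walk (adjacency T) x (y ∷ ys) z
      ≡⟨ cong (_* walk (adjacency T) x (y ∷ ys) z) (ℤ.pos-* 2 (2 ℕ.^ suc (length ys))) ⟨
    + (2 ℕ.^ suc (suc (length ys))) * walk (adjacency T) x (y ∷ ys) z ∎
    where
    open ≡-Reasoning
    regroup : ∀ a p w → + 2 * a * (p * w) ≡ + 2 * p * (a * w)
    regroup = solve-∀

  walk-adjacency : ∀ x ys z → walk (adjacency T) x ys z ≡ indicator (chain T (x ∷ ys) ∧ lastArc T z (x ∷ ys))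
  walk-adjacency x []       z = refl
  walk-adjacency x (y ∷ ys) z = begin
    adjacency T x y * walk (adjacency T) y ys z
      ≡⟨ cong (adjacency T x y *_) (walk-adjacency y ys z) ⟩
    adjacency T x y * indicator (chain T (y ∷ ys) ∧ lastArc T z (y ∷ ys))
      ≡⟨ indicator-∧ (arc T x y) _ ⟨
    indicator (arc T x y ∧ (chain T (y ∷ ys) ∧ lastArc T z (y ∷ ys)))
      ≡⟨ cong indicator (∧-assoc (arc T x y) (chain T (y ∷ ys)) (lastArc T z (y ∷ ys))) ⟨
    indicator ((arc T x y ∧ chain T (y ∷ ys)) ∧ lastArc T z (y ∷ ys)) ∎
    where open ≡-Reasoning

  closedWalk-distinct : ∀ {k} xs → length xs ≡ suc (suc k) → distinct xs ≡ true →
    closedWalk M xs ≡ + (2 ℕ.^ suc (suc k)) * indicator (isCycleSeq T xs)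
  closedWalk-distinct xs@(x ∷ y ∷ ys) refl d with distinct⇒Unique xs d
  ... | unique@((x≢y ∷ _) ∷ _) = begin
    walk M x (y ∷ ys) x
      ≡⟨ walk-Linked x (y ∷ ys) x (x≢y ∷ linked) ⟩
    + (2 ℕ.^ length xs) * walk (adjacency T) x (y ∷ ys) x
      ≡⟨ cong (+ (2 ℕ.^ length xs) *_) (walk-adjacency x (y ∷ ys) x) ⟩
    + (2 ℕ.^ length xs) * indicator (closed T xs)
      ≡⟨ cong (λ b → + (2 ℕ.^ length xs) * indicator (b ∧ closed T xs)) d ⟨
    + (2 ℕ.^ length xs) * indicator (isCycleSeq T xs) ∎
    where
    open ≡-Reasoning
    linked : Linked _≢_ (y ∷ ys ++ [ x ])
    linked = AllPairs⇒Linked (AllPairs-resp-↭ ≢-sym (↭.∷↭∷ʳ x (y ∷ ys)) unique)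

  closedWalk-≤ : ∀ {k} xs → length xs ≡ suc k → closedWalk M xs ≤ + (2 ℕ.^ suc k)
  closedWalk-≤ (x ∷ xs) refl = walk-≤ x xs x

  0≤closedWalk : ∀ xs → 0ℤ ≤ closedWalk M xs
  0≤closedWalk []       = ℤ.≤-refl
  0≤closedWalk (x ∷ xs) = 0≤walk x xs x

  ∑-isCycleSeq : ∀ c ℓ → (∑[ xs ∈ allSeqs n ℓ ] + c * indicator (isCycleSeq T xs)) ≡ + c * + cycleSeqs T ℓ
  ∑-isCycleSeq c ℓ = begin
    (∑[ xs ∈ allSeqs n ℓ ] + c * indicator (isCycleSeq T xs))
      ≡⟨ *-distribˡ-∑ (+ c) (allSeqs n ℓ) _ ⟨
    + c * (∑[ xs ∈ allSeqs n ℓ ] indicator (isCycleSeq T xs))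
      ≡⟨ cong (+ c *_) (length-filter-≟true (isCycleSeq T) (allSeqs n ℓ)) ⟨
    + c * + cycleSeqs T ℓ ∎
    where open ≡-Reasoning

module _ {I : Set} {size : I → ℕ} (T : ∀ i → Tournament (size i)) (k : ℕ) where

  private
    ℓ 2^ℓ : ℕ
    ℓ = suc (suc k)
    2^ℓ = 2 ℕ.^ ℓ

    F G : ∀ i → List (Fin (size i)) → ℤ
    F i    = closedWalk (J+ signMatrix (T i))
    G i xs = + 2^ℓ * indicator (isCycleSeq (T i) xs)

  open Asymptotics size (suc k)

  trace≲cycleSeqs : (λ i → trace (J+ signMatrix (T i)) (suc k)) ≲ (λ i → + 2^ℓ * + cycleSeqs (T i) ℓ)
  trace≲cycleSeqs = begin
    (λ i → trace (J+ signMatrix (T i)) (suc k))     ≈⟨ (λ i → ∑-closedWalk (J+ signMatrix (T i)) (suc k)) ⟨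
    (λ i → ∑ (allSeqs (size i) ℓ) (F i))            ≲⟨ ∑-mono-distinct size (suc k) F G 2^ℓ F≤G F≤G+2^ℓ ⟩
    (λ i → ∑ (allSeqs (size i) ℓ) (G i))            ≈⟨ (λ i → ∑-isCycleSeq (T i) 2^ℓ ℓ) ⟩
    (λ i → + 2^ℓ * + cycleSeqs (T i) ℓ)             ∎
    where
    open ≲-Reasoning
    F≤G : ∀ i xs → length xs ≡ ℓ → distinct xs ≡ true → F i xs ≤ G i xs
    F≤G i xs |xs|≡ℓ d = ℤ.≤-reflexive (closedWalk-distinct (T i) xs |xs|≡ℓ d)
    0≤G : ∀ i xs → 0ℤ ≤ G i xs
    0≤G i xs = 0≤i*j {+ 2^ℓ} (ℤ.+≤+ ℕ.z≤n) (0≤indicator (isCycleSeq (T i) xs))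
    F≤G+2^ℓ : ∀ i xs → length xs ≡ ℓ → F i xs ≤ G i xs + + 2^ℓ
    F≤G+2^ℓ i xs |xs|≡ℓ = ℤ.≤-trans (closedWalk-≤ (T i) xs |xs|≡ℓ)
      (ℤ.i≤j+i (+ 2^ℓ) (G i xs) {{ℤ.nonNegative (0≤G i xs)}})

  cycleSeqs≲trace : (λ i → + 2^ℓ * + cycleSeqs (T i) ℓ) ≲ (λ i → trace (J+ signMatrix (T i)) (suc k))
  cycleSeqs≲trace = begin
    (λ i → + 2^ℓ * + cycleSeqs (T i) ℓ)             ≈⟨ (λ i → ∑-isCycleSeq (T i) 2^ℓ ℓ) ⟨
    (λ i → ∑ (allSeqs (size i) ℓ) (G i))            ≲⟨ ∑-mono-distinct size (suc k) G F 2^ℓ G≤F G≤F+2^ℓ ⟩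
    (λ i → ∑ (allSeqs (size i) ℓ) (F i))            ≈⟨ (λ i → ∑-closedWalk (J+ signMatrix (T i)) (suc k)) ⟩
    (λ i → trace (J+ signMatrix (T i)) (suc k))     ∎
    where
    open ≲-Reasoning
    G≤F : ∀ i xs → length xs ≡ ℓ → distinct xs ≡ true → G i xs ≤ F i xs
    G≤F i xs |xs|≡ℓ d = ℤ.≤-reflexive (sym (closedWalk-distinct (T i) xs |xs|≡ℓ d))
    G≤F+2^ℓ : ∀ i xs → length xs ≡ ℓ → G i xs ≤ F i xs + + 2^ℓ
    G≤F+2^ℓ i xs _ = ℤ.≤-trans (n*indicator≤n 2^ℓ (isCycleSeq (T i) xs))
      (ℤ.i≤j+i (+ 2^ℓ) (F i xs) {{ℤ.nonNegative (0≤closedWalk (T i) xs)}})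

-- Switching

-- The tournament off v after switching the out-neighbours of v, that is, reversing all arcs between them and
-- the other vertices; then every arc at v points to v.
switched : Tournament n → Fin n → Fin n → Fin n → Bool
switched T v x y = arc T x v xor (arc T x y xor arc T y v)

symmetrise : (List A → ℤ) → List A → ℤ
symmetrise F []       = F []
symmetrise F (x ∷ xs) = ∑[ ys ∈ permutations xs ] F (x ∷ ys)

∑-symmetrise : ∀ n k F → ∑ (allSeqs n (suc k)) (symmetrise F) ≡ + (k !) * ∑ (allSeqs n (suc k)) F
∑-symmetrise n k F = begin
  ∑ (allSeqs n (suc k)) (symmetrise F)
    ≡⟨ ∑-allSeqs-suc n k (symmetrise F) ⟩
  (∑[ x ∈ allFin n ] ∑[ xs ∈ allSeqs n k ] ∑[ ys ∈ permutations xs ] F (x ∷ ys))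
    ≡⟨ ∑-cong (allFin n) (λ x → ∑-allSeqs-permutations n k (F ∘ (x ∷_))) ⟩
  (∑[ x ∈ allFin n ] + (k !) * (∑[ xs ∈ allSeqs n k ] F (x ∷ xs)))
    ≡⟨ *-distribˡ-∑ (+ (k !)) (allFin n) _ ⟨
  + (k !) * (∑[ x ∈ allFin n ] ∑[ xs ∈ allSeqs n k ] F (x ∷ xs))
    ≡⟨ cong (+ (k !) *_) (∑-allSeqs-suc n k F) ⟨
  + (k !) * ∑ (allSeqs n (suc k)) F ∎
  where open ≡-Reasoning

module _ (T : Tournament n) where

  private
    K : Matrix n
    K = signMatrix T

  signMatrix²≡1 : ∀ {x y} → x ≢ y → K x y * K x y ≡ 1ℤ
  signMatrix²≡1 {x} {y} x≢y = trans (cong₂ _*_ (signMatrix-≢ T x≢y) (signMatrix-≢ T x≢y)) (sign*sign≡1 (arc T x y))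

  switched-skew : ∀ v {x y} → x ≢ y → switched T v y x ≡ not (switched T v x y)
  switched-skew v {x} {y} x≢y = trans
    (cong (λ b → arc T y v xor (b xor arc T x v)) (total T y x (≢-sym x≢y)))
    (solve 3 (λ a b c → c :+ ((con true :+ b) :+ a) := con true :+ (a :+ (b :+ c))) refl
       (arc T x v) (arc T x y) (arc T y v))
    where open xor-∧-Solver

  sign-switched : ∀ {v x y} → x ≢ v → y ≢ v → x ≢ y → sign (switched T v x y) ≡ K x v * (K x y * K y v)
  sign-switched {v} {x} {y} x≢v y≢v x≢y = begin
    sign (arc T x v xor (arc T x y xor arc T y v))
      ≡⟨ sign-xor (arc T x v) _ ⟩
    - (sign (arc T x v) * sign (arc T x y xor arc T y v))
      ≡⟨ cong (λ s → - (sign (arc T x v) * s)) (sign-xor (arc T x y) (arc T y v)) ⟩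
    - (sign (arc T x v) * - (sign (arc T x y) * sign (arc T y v)))
      ≡⟨ cancel (sign (arc T x v)) _ ⟩
    sign (arc T x v) * (sign (arc T x y) * sign (arc T y v))
      ≡⟨ cong₂ _*_ (signMatrix-≢ T x≢v) (cong₂ _*_ (signMatrix-≢ T x≢y) (signMatrix-≢ T y≢v)) ⟨
    K x v * (K x y * K y v) ∎
    where
    open ≡-Reasoning
    cancel : ∀ a b → - (a * - b) ≡ a * b
    cancel = solve-∀

  walk-switched : ∀ {v} x ys → Unique (x ∷ ys) → All (_≢ v) (x ∷ ys) →
    walk K x ys v ≡ K x v * pathSign (switched T v) (x ∷ ys)
  walk-switched {v} x []       _                    _                    = sym (ℤ.*-identityʳ (K x v))
  walk-switched {v} x (y ∷ ys) ((x≢y ∷ _) ∷ unique) (x≢v ∷ ≢v@(y≢v ∷ _)) = begin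
    K x y * walk K y ys v                     ≡⟨ cong (K x y *_) (walk-switched y ys unique ≢v) ⟩
    K x y * (K y v * P)                       ≡⟨ trans (ℤ.*-identityˡ _) (ℤ.*-assoc (K x y) (K y v) P) ⟨
    1ℤ * (K x y * K y v * P)                  ≡⟨ cong (_* (K x y * K y v * P)) (signMatrix²≡1 x≢v) ⟨
    K x v * K x v * (K x y * K y v * P)       ≡⟨ regroup (K x v) (K x y * K y v) P ⟩
    K x v * (K x v * (K x y * K y v) * P)     ≡⟨ cong (λ s → K x v * (s * P)) (sign-switched x≢v y≢v x≢y) ⟨
    K x v * (sign (switched T v x y) * P)     ∎
    where
    open ≡-Reasoning
    P : ℤ
    P = pathSign (switched T v) (y ∷ ys)
    regroup : ∀ a b p → a * a * (b * p) ≡ a * (a * b * p)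
    regroup = solve-∀

  closedWalk-switched : ∀ v y ys → Unique (v ∷ y ∷ ys) →
    closedWalk K (v ∷ y ∷ ys) ≡ - pathSign (switched T v) (y ∷ ys)
  closedWalk-switched v y ys (v≢@(v≢y ∷ _) ∷ unique) = begin
    K v y * walk K y ys v      ≡⟨ cong₂ _*_ (signMatrix-skew T y v) (walk-switched y ys unique (All.map ≢-sym v≢)) ⟩
    - K y v * (K y v * P)      ≡⟨ regroup (K y v) P ⟩
    - (K y v * K y v * P)      ≡⟨ cong (λ s → - (s * P)) (signMatrix²≡1 (≢-sym v≢y)) ⟩
    - (1ℤ * P)                 ≡⟨ cong -_ (ℤ.*-identityˡ P) ⟩
    - P                        ∎
    where
    open ≡-Reasoning
    P : ℤ
    P = pathSign (switched T v) (y ∷ ys)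
    regroup : ∀ a p → - a * (a * p) ≡ - (a * a * p)
    regroup = solve-∀

  symmetrise-closedWalk : ∀ {k} v xs → length xs ≡ suc k → Unique (v ∷ xs) →
    symmetrise (closedWalk K) (v ∷ xs) ≡ - signedPaths (switched T v) xs
  symmetrise-closedWalk v xs |xs|≡1+k unique = begin
    (∑[ ys ∈ permutations xs ] closedWalk K (v ∷ ys))
      ≡⟨ ∑-cong-All (All.map (λ {ys} → pointwise ys) (permutations-↭ xs)) ⟩
    (∑[ ys ∈ permutations xs ] - 1ℤ * pathSign (switched T v) ys)
      ≡⟨ *-distribˡ-∑ (- 1ℤ) (permutations xs) _ ⟨
    - 1ℤ * signedPaths (switched T v) xs
      ≡⟨ ℤ.-1*i≡-i (signedPaths (switched T v) xs) ⟩
    - signedPaths (switched T v) xs ∎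
    where
    open ≡-Reasoning
    pointwise : ∀ ys → ys ↭ xs → closedWalk K (v ∷ ys) ≡ - 1ℤ * pathSign (switched T v) ys
    pointwise []       []↭xs = contradiction (trans (↭.↭-length []↭xs) |xs|≡1+k) λ ()
    pointwise (y ∷ ys) ys↭xs = trans
      (closedWalk-switched v y ys (AllPairs-resp-↭ ≢-sym (↭-prep v (↭-sym ys↭xs)) unique))
      (sym (ℤ.-1*i≡-i (pathSign (switched T v) (y ∷ ys))))

  ∣walk∣≤1 : ∀ x ys z → ∣ walk K x ys z ∣ ℕ.≤ 1
  ∣walk∣≤1 x []       z = ∣signMatrix∣≤1 T x z
  ∣walk∣≤1 x (y ∷ ys) z = subst (ℕ._≤ 1) (sym (ℤ.abs-* (K x y) (walk K y ys z)))
    (ℕ.*-mono-≤ (∣signMatrix∣≤1 T x y) (∣walk∣≤1 y ys z))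

  ∣symmetrise-closedWalk∣≤k! : ∀ {k} xs → length xs ≡ suc k → ∣ symmetrise (closedWalk K) xs ∣ ℕ.≤ k !
  ∣symmetrise-closedWalk∣≤k! (v ∷ xs) refl = subst (∣ symmetrise (closedWalk K) (v ∷ xs) ∣ ℕ.≤_)
    (trans (ℕ.*-identityʳ (length (permutations xs))) (length-permutations xs))
    (∣∑∣-≤ (permutations xs) λ ys → ∣walk∣≤1 v ys v)

  ∑-symmetrise-closedWalk : ∀ k → ∑ (allSeqs n (suc k)) (symmetrise (closedWalk K)) ≡ + (k !) * trace K k
  ∑-symmetrise-closedWalk k = trans (∑-symmetrise n k (closedWalk K)) (cong (+ (k !) *_) (∑-closedWalk K k))

  symmetrise-closedWalk-≤ : ∀ {k} xs → length xs ≡ suc (suc k) → distinct xs ≡ true →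
    symmetrise (closedWalk K) xs ≤ - minSignedPaths (suc k) (chords (suc k))
  symmetrise-closedWalk-≤ {k} (v ∷ xs) |vxs|≡2+k d with distinct⇒Unique (v ∷ xs) d
  ... | unique@(_ ∷ unique-xs) = begin
    symmetrise (closedWalk K) (v ∷ xs)
      ≡⟨ symmetrise-closedWalk v xs |xs|≡1+k unique ⟩
    - signedPaths (switched T v) xs
      ≤⟨ ℤ.neg-mono-≤ (signedPaths-≥ (switched T v) xs (AllPairs.map (switched-skew v) unique-xs)) ⟩
    - minSignedPaths (length xs) (chords (length xs))
      ≡⟨ cong (λ m → - minSignedPaths m (chords m)) |xs|≡1+k ⟩
    - minSignedPaths (suc k) (chords (suc k)) ∎
    where
    open ℤ.≤-Reasoning
    |xs|≡1+k : length xs ≡ suc k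
    |xs|≡1+k = ℕ.suc-injective |vxs|≡2+k

  symmetrise-closedWalk-transitive : (∀ v → Transitive (Arcs._⟶_ (switched T v))) →
    ∀ {k} xs → length xs ≡ suc (suc k) → distinct xs ≡ true →
    symmetrise (closedWalk K) xs ≡ - minSignedPaths (suc k) []
  symmetrise-closedWalk-transitive ⟶-trans {k} (v ∷ xs) |vxs|≡2+k d with distinct⇒Unique (v ∷ xs) d
  ... | unique@(_ ∷ unique-xs) = begin
    symmetrise (closedWalk K) (v ∷ xs)
      ≡⟨ symmetrise-closedWalk v xs |xs|≡1+k unique ⟩
    - signedPaths (switched T v) xs
      ≡⟨ cong -_ (signedPaths-transitive (switched T v) (⟶-trans v) xs (AllPairs.map (switched-skew v) unique-xs)) ⟩
    - minSignedPaths (length xs) []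
      ≡⟨ cong (λ m → - minSignedPaths m []) |xs|≡1+k ⟩
    - minSignedPaths (suc k) [] ∎
    where
    open ≡-Reasoning
    |xs|≡1+k : length xs ≡ suc k
    |xs|≡1+k = ℕ.suc-injective |vxs|≡2+k

module _ {I : Set} {size : I → ℕ} (T : ∀ i → Tournament (size i)) (k B : ℕ) where

  private
    j ℓ 2^ℓ : ℕ
    j = suc k
    ℓ = suc j
    2^ℓ = 2 ℕ.^ ℓ

    K : ∀ i → Matrix (size i)
    K i = signMatrix (T i)

    F G : ∀ i → List (Fin (size i)) → ℤ
    F i   = symmetrise (closedWalk (K i))
    G i _ = + B

    ∑F : ∀ i → ∑ (allSeqs (size i) ℓ) (F i) ≡ + (j !) * trace (K i) j
    ∑F i = ∑-symmetrise-closedWalk (T i) j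

    ∑G : ∀ i → ∑ (allSeqs (size i) ℓ) (G i) ≡ + B * (+ size i) ^ ℓ
    ∑G i = trans (∑-allSeqs-const (size i) ℓ (+ B)) (ℤ.*-comm ((+ size i) ^ ℓ) (+ B))

    j!*trace-J+ : ∀ i → + (j !) * trace (J+ K i) j ≡ + (j !) * excess (moment (K i)) j + + (j !) * trace (K i) j
    j!*trace-J+ i = trans (cong (+ (j !) *_) (trace-J+ (K i) j)) (ℤ.*-distribˡ-+ (+ (j !)) (excess (moment (K i)) j) _)

    collect : ∀ i → + (j !) * (+ size i) ^ ℓ + + B * (+ size i) ^ ℓ ≡ + (j ! ℕ.+ B) * (+ size i) ^ ℓ
    collect i = sym (ℤ.*-distribʳ-+ ((+ size i) ^ ℓ) (+ (j !)) (+ B))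

  open Asymptotics size j

  trace-≲ : minSignedPaths j (chords j) ≡ - + B → (λ i → + (j !) * trace (K i) j) ≲ (λ i → + B * (+ size i) ^ ℓ)
  trace-≲ min≡-B = begin
    (λ i → + (j !) * trace (K i) j)          ≈⟨ ∑F ⟨
    (λ i → ∑ (allSeqs (size i) ℓ) (F i))     ≲⟨ ∑-mono-distinct size j F G (j !) F≤G F≤G+j! ⟩
    (λ i → ∑ (allSeqs (size i) ℓ) (G i))     ≈⟨ ∑G ⟩
    (λ i → + B * (+ size i) ^ ℓ)             ∎
    where
    open ≲-Reasoning
    F≤G : ∀ i xs → length xs ≡ ℓ → distinct xs ≡ true → F i xs ≤ + B
    F≤G i xs |xs|≡ℓ d = subst (F i xs ≤_) (trans (cong -_ min≡-B) (ℤ.neg-involutive (+ B)))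
      (symmetrise-closedWalk-≤ (T i) xs |xs|≡ℓ d)
    F≤G+j! : ∀ i xs → length xs ≡ ℓ → F i xs ≤ + B + + (j !)
    F≤G+j! i xs |xs|≡ℓ =
      ℤ.≤-trans (∣i∣≤n⇒i≤n (F i xs) (∣symmetrise-closedWalk∣≤k! (T i) xs |xs|≡ℓ)) (ℤ.i≤j+i (+ (j !)) (+ B))

  trace-≳ : minSignedPaths j [] ≡ - + B → (∀ i v → Transitive (Arcs._⟶_ (switched (T i) v))) →
    (λ i → + B * (+ size i) ^ ℓ) ≲ (λ i → + (j !) * trace (K i) j)
  trace-≳ min≡-B ⟶-trans = begin
    (λ i → + B * (+ size i) ^ ℓ)             ≈⟨ ∑G ⟨
    (λ i → ∑ (allSeqs (size i) ℓ) (G i))     ≲⟨ ∑-mono-distinct size j G F (B ℕ.+ j !) G≤F G≤F+B+j! ⟩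
    (λ i → ∑ (allSeqs (size i) ℓ) (F i))     ≈⟨ ∑F ⟩
    (λ i → + (j !) * trace (K i) j)          ∎
    where
    open ≲-Reasoning
    G≤F : ∀ i xs → length xs ≡ ℓ → distinct xs ≡ true → + B ≤ F i xs
    G≤F i xs |xs|≡ℓ d = ℤ.≤-reflexive (sym (trans (symmetrise-closedWalk-transitive (T i) (⟶-trans i) xs |xs|≡ℓ d)
      (trans (cong -_ min≡-B) (ℤ.neg-involutive (+ B)))))
    G≤F+B+j! : ∀ i xs → length xs ≡ ℓ → + B ≤ F i xs + + (B ℕ.+ j !)
    G≤F+B+j! i xs |xs|≡ℓ = subst (_≤ F i xs + + (B ℕ.+ j !)) (cancel (+ B) (+ (j !)))
      (ℤ.+-monoˡ-≤ (+ B + + (j !)) (∣i∣≤n⇒-n≤i (F i xs) (∣symmetrise-closedWalk∣≤k! (T i) xs |xs|≡ℓ)))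
      where
      cancel : ∀ b f → - f + (b + f) ≡ b
      cancel = solve-∀

  cycleSeqs-≲ : minSignedPaths j (chords j) ≡ - + B → (λ i → excess (moment (K i)) j) ≲ (λ i → (+ size i) ^ ℓ) →
    (λ i → + (j !) * (+ 2^ℓ * + cycleSeqs (T i) ℓ)) ≲ (λ i → + (j ! ℕ.+ B) * (+ size i) ^ ℓ)
  cycleSeqs-≲ min≡-B excess≲ = begin
    (λ i → + (j !) * (+ 2^ℓ * + cycleSeqs (T i) ℓ))
      ≲⟨ *-monoˡ-≲ (j !) (cycleSeqs≲trace T k) ⟩
    (λ i → + (j !) * trace (J+ K i) j)
      ≈⟨ j!*trace-J+ ⟩
    (λ i → + (j !) * excess (moment (K i)) j + + (j !) * trace (K i) j)
      ≲⟨ +-mono-≲ (*-monoˡ-≲ (j !) excess≲) (trace-≲ min≡-B) ⟩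
    (λ i → + (j !) * (+ size i) ^ ℓ + + B * (+ size i) ^ ℓ)
      ≈⟨ collect ⟩
    (λ i → + (j ! ℕ.+ B) * (+ size i) ^ ℓ) ∎
    where open ≲-Reasoning

  cycleSeqs-≳ : minSignedPaths j [] ≡ - + B → (∀ i v → Transitive (Arcs._⟶_ (switched (T i) v))) →
    (λ i → (+ size i) ^ ℓ) ≲ (λ i → excess (moment (K i)) j) →
    (λ i → + (j ! ℕ.+ B) * (+ size i) ^ ℓ) ≲ (λ i → + (j !) * (+ 2^ℓ * + cycleSeqs (T i) ℓ))
  cycleSeqs-≳ min≡-B ⟶-trans ≲excess = begin
    (λ i → + (j ! ℕ.+ B) * (+ size i) ^ ℓ)
      ≈⟨ collect ⟨
    (λ i → + (j !) * (+ size i) ^ ℓ + + B * (+ size i) ^ ℓ)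
      ≲⟨ +-mono-≲ (*-monoˡ-≲ (j !) ≲excess) (trace-≳ min≡-B ⟶-trans) ⟩
    (λ i → + (j !) * excess (moment (K i)) j + + (j !) * trace (K i) j)
      ≈⟨ j!*trace-J+ ⟨
    (λ i → + (j !) * trace (J+ K i) j)
      ≲⟨ *-monoˡ-≲ (j !) (trace≲cycleSeqs T k) ⟩
    (λ i → + (j !) * (+ 2^ℓ * + cycleSeqs (T i) ℓ)) ∎
    where open ≲-Reasoning

-- The alternating tournament

even : Fin n → Bool
even zero    = true
even (suc i) = not (even i)

-- The transitive tournament switched at every other vertex.
alternatingTournament : ∀ n → Tournament n
alternatingTournament n = record { arc = alternating ; irrefl = alternating-irrefl ; total = alternating-total }
  where
  alternating : Fin n → Fin n → Bool
  alternating i j = (toℕ i ℕ.<ᵇ toℕ j) xor (even i xor even j)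
  alternating-irrefl : ∀ i → alternating i i ≡ false
  alternating-irrefl i = cong₂ _xor_ (≥⇒<ᵇ≡false (ℕ.≤-refl {toℕ i})) (xor-same (even i))
  alternating-total : ∀ i j → i ≢ j → alternating i j ≡ not (alternating j i)
  alternating-total i j i≢j = trans (cong (_xor (even i xor even j)) (<ᵇ-not (i≢j ∘ Fin.toℕ-injective)))
    (solve 3 (λ b e f → (con true :+ b) :+ (e :+ f) := con true :+ (b :+ (f :+ e))) refl
       (toℕ j ℕ.<ᵇ toℕ i) (even i) (even j))
    where open xor-∧-Solver

cyclicRank : Fin n → Fin n → ℕ
cyclicRank {n} v x = if toℕ x ℕ.<ᵇ toℕ v then n ℕ.+ toℕ x else toℕ x

module _ {n : ℕ} where

  private
    t : Fin n → Fin n → Fin n → Bool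
    t = switched (alternatingTournament n)

    _<ᵇ_ : Fin n → Fin n → Bool
    x <ᵇ y = toℕ x ℕ.<ᵇ toℕ y

  switched-alternating : ∀ v x y → t v x y ≡ (cyclicRank v x ℕ.<ᵇ cyclicRank v y)
  switched-alternating v x y = trans cancelParities cyclic
    where
    open xor-∧-Solver
    cancelParities : t v x y ≡ (x <ᵇ v) xor ((x <ᵇ y) xor (y <ᵇ v))
    cancelParities = solve 6
      (λ a b c u e f → (a :+ (e :+ u)) :+ ((b :+ (e :+ f)) :+ (c :+ (f :+ u))) := a :+ (b :+ c)) refl
      (x <ᵇ v) (x <ᵇ y) (y <ᵇ v) (even v) (even x) (even y)
    cyclic : (x <ᵇ v) xor ((x <ᵇ y) xor (y <ᵇ v)) ≡ (cyclicRank v x ℕ.<ᵇ cyclicRank v y)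
    cyclic with x <ᵇ v in x<ᵇv | y <ᵇ v in y<ᵇv
    ... | true  | true  = trans (solve 1 (λ b → con true :+ (b :+ con true) := b) refl (x <ᵇ y))
                                (sym (+-cancelˡ-<ᵇ n (toℕ x) (toℕ y)))
    ... | false | false = xor-identityʳ (x <ᵇ y)
    ... | true  | false = trans (cong (λ b → true xor (b xor false)) (<⇒<ᵇ≡true x<y))
                                (sym (≥⇒<ᵇ≡false (ℕ.≤-trans (ℕ.<⇒≤ (Fin.toℕ<n y)) (ℕ.m≤m+n n (toℕ x)))))
      where
      x<y : toℕ x ℕ.< toℕ y
      x<y = ℕ.<-≤-trans (<ᵇ≡true⇒< {toℕ x} {toℕ v} x<ᵇv) (<ᵇ≡false⇒≥ {toℕ y} {toℕ v} y<ᵇv)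
    ... | false | true  = trans (cong (_xor true) (≥⇒<ᵇ≡false y≤x))
                                (sym (<⇒<ᵇ≡true (ℕ.<-≤-trans (Fin.toℕ<n x) (ℕ.m≤m+n n (toℕ y)))))
      where
      y≤x : toℕ y ℕ.≤ toℕ x
      y≤x = ℕ.≤-trans (ℕ.<⇒≤ (<ᵇ≡true⇒< {toℕ y} {toℕ v} y<ᵇv)) (<ᵇ≡false⇒≥ {toℕ x} {toℕ v} x<ᵇv)

  switched-alternating-trans : ∀ v → Transitive (Arcs._⟶_ (t v))
  switched-alternating-trans v {x} {y} {z} x⟶y y⟶z = trans (switched-alternating v x z)
    (<⇒<ᵇ≡true (ℕ.<-trans (rank-< x⟶y) (rank-< y⟶z)))
    where
    rank-< : ∀ {x y} → t v x y ≡ true → cyclicRank v x ℕ.< cyclicRank v y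
    rank-< {x} {y} x⟶y = <ᵇ≡true⇒< (trans (sym (switched-alternating v x y)) x⟶y)

ε : Fin n → ℤ
ε i = sign (even i)

ε-suc : ∀ (i : Fin n) → ε (suc i) ≡ - 1ℤ * ε i
ε-suc i = trans (sign-not (even i)) (sym (ℤ.-1*i≡-i (ε i)))

∑-ε-suc : ∀ n → ∑ (allFin (suc n)) ε ≡ 1ℤ - ∑ (allFin n) ε
∑-ε-suc n = begin
  ∑ (allFin (suc n)) ε                             ≡⟨ ∑-allFin-suc n ε ⟩
  1ℤ + (∑[ i ∈ allFin n ] ε (suc i))               ≡⟨ cong (λ s → 1ℤ + s) (∑-cong (allFin n) ε-suc) ⟩
  1ℤ + (∑[ i ∈ allFin n ] - 1ℤ * ε i)              ≡⟨ cong (λ s → 1ℤ + s) (*-distribˡ-∑ (- 1ℤ) (allFin n) ε) ⟨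
  1ℤ + - 1ℤ * ∑ (allFin n) ε                       ≡⟨ cong (λ s → 1ℤ + s) (ℤ.-1*i≡-i (∑ (allFin n) ε)) ⟩
  1ℤ - ∑ (allFin n) ε                              ∎
  where open ≡-Reasoning

∑-ε : ∀ n → ∑ (allFin n) ε ≡ 0ℤ ⊎ ∑ (allFin n) ε ≡ 1ℤ
∑-ε zero    = inj₁ refl
∑-ε (suc n) with ∑-ε n
... | inj₁ S≡0 = inj₂ (trans (∑-ε-suc n) (cong (λ s → 1ℤ - s) S≡0))
... | inj₂ S≡1 = inj₁ (trans (∑-ε-suc n) (cong (λ s → 1ℤ - s) S≡1))

sgn : Fin n → Fin n → ℤ
sgn zero    zero    = 0ℤ
sgn zero    (suc j) = 1ℤ
sgn (suc i) zero    = - 1ℤ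
sgn (suc i) (suc j) = sgn i j

∑-sgn*ε : ∀ {n} (i : Fin n) → (∑[ j ∈ allFin n ] sgn i j * ε j) ≡ ∑ (allFin n) ε - 1ℤ
∑-sgn*ε {suc n} zero = begin
  (∑[ j ∈ allFin (suc n) ] sgn zero j * ε j)
    ≡⟨ ∑-allFin-suc n (λ j → sgn zero j * ε j) ⟩
  0ℤ + (∑[ j ∈ allFin n ] 1ℤ * ε (suc j))
    ≡⟨ cong (λ s → 0ℤ + s) (∑-cong (allFin n) λ j → ℤ.*-identityˡ (ε (suc j))) ⟩
  0ℤ + (∑[ j ∈ allFin n ] ε (suc j))
    ≡⟨ cancel (∑[ j ∈ allFin n ] ε (suc j)) ⟩
  1ℤ + (∑[ j ∈ allFin n ] ε (suc j)) - 1ℤ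
    ≡⟨ cong (_- 1ℤ) (∑-allFin-suc n ε) ⟨
  ∑ (allFin (suc n)) ε - 1ℤ ∎
  where
  open ≡-Reasoning
  cancel : ∀ s → 0ℤ + s ≡ 1ℤ + s - 1ℤ
  cancel = solve-∀
∑-sgn*ε {suc n} (suc i) = begin
  (∑[ j ∈ allFin (suc n) ] sgn (suc i) j * ε j)           ≡⟨ ∑-allFin-suc n (λ j → sgn (suc i) j * ε j) ⟩
  - 1ℤ + (∑[ j ∈ allFin n ] sgn i j * ε (suc j))          ≡⟨ cong (λ s → - 1ℤ + s) (∑-cong (allFin n) sgn*ε-suc) ⟩
  - 1ℤ + (∑[ j ∈ allFin n ] - 1ℤ * (sgn i j * ε j))       ≡⟨ cong (λ s → - 1ℤ + s) (*-distribˡ-∑ (- 1ℤ) (allFin n) _) ⟨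
  - 1ℤ + - 1ℤ * (∑[ j ∈ allFin n ] sgn i j * ε j)         ≡⟨ cong (λ s → - 1ℤ + - 1ℤ * s) (∑-sgn*ε i) ⟩
  - 1ℤ + - 1ℤ * (∑ (allFin n) ε - 1ℤ)                     ≡⟨ regroup (∑ (allFin n) ε) ⟩
  1ℤ - ∑ (allFin n) ε - 1ℤ                                ≡⟨ cong (_- 1ℤ) (∑-ε-suc n) ⟨
  ∑ (allFin (suc n)) ε - 1ℤ                               ∎
  where
  open ≡-Reasoning
  exchange : ∀ a b → a * (- 1ℤ * b) ≡ - 1ℤ * (a * b)
  exchange = solve-∀
  sgn*ε-suc : ∀ j → sgn i j * ε (suc j) ≡ - 1ℤ * (sgn i j * ε j)
  sgn*ε-suc j = trans (cong (sgn i j *_) (ε-suc j)) (exchange (sgn i j) (ε j))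
  regroup : ∀ s → - 1ℤ + - 1ℤ * (s - 1ℤ) ≡ 1ℤ - s - 1ℤ
  regroup = solve-∀

sgn-refl : (i : Fin n) → sgn i i ≡ 0ℤ
sgn-refl zero    = refl
sgn-refl (suc i) = sgn-refl i

sgn-≢ : (i j : Fin n) → i ≢ j → sgn i j ≡ sign (toℕ i ℕ.<ᵇ toℕ j)
sgn-≢ zero    zero    i≢j = contradiction refl i≢j
sgn-≢ zero    (suc j) _   = refl
sgn-≢ (suc i) zero    _   = refl
sgn-≢ (suc i) (suc j) i≢j = sgn-≢ i j (i≢j ∘ cong suc)

module _ (n : ℕ) where

  private
    K : Matrix n
    K = signMatrix (alternatingTournament n)

  signMatrix-alternating : ∀ i j → K i j ≡ ε i * (sgn i j * ε j)
  signMatrix-alternating i j with i Fin.≟ j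
  ... | yes refl = sym (trans (cong (λ s → ε i * (s * ε i)) (sgn-refl i)) (ℤ.*-zeroʳ (ε i)))
  ... | no  i≢j  = begin
    sign ((toℕ i ℕ.<ᵇ toℕ j) xor (even i xor even j))
      ≡⟨ sign-xor (toℕ i ℕ.<ᵇ toℕ j) (even i xor even j) ⟩
    - (sign (toℕ i ℕ.<ᵇ toℕ j) * sign (even i xor even j))
      ≡⟨ cong₂ (λ a b → - (a * b)) (sym (sgn-≢ i j i≢j)) (sign-xor (even i) (even j)) ⟩
    - (sgn i j * - (ε i * ε j))
      ≡⟨ regroup (sgn i j) (ε i) (ε j) ⟩
    ε i * (sgn i j * ε j) ∎
    where
    open ≡-Reasoning
    regroup : ∀ s a b → - (s * - (a * b)) ≡ a * (s * b)
    regroup = solve-∀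

  rowSum-alternating : ∀ i → (K · 𝟏) i ≡ ε i * (∑ (allFin n) ε - 1ℤ)
  rowSum-alternating i = begin
    (∑[ j ∈ allFin n ] K i j * 1ℤ)
      ≡⟨ ∑-cong (allFin n) (λ j → trans (ℤ.*-identityʳ (K i j)) (signMatrix-alternating i j)) ⟩
    (∑[ j ∈ allFin n ] ε i * (sgn i j * ε j))
      ≡⟨ *-distribˡ-∑ (ε i) (allFin n) _ ⟨
    ε i * (∑[ j ∈ allFin n ] sgn i j * ε j)
      ≡⟨ cong (ε i *_) (∑-sgn*ε i) ⟩
    ε i * (∑ (allFin n) ε - 1ℤ) ∎
    where open ≡-Reasoning

  ∣rowSum-alternating∣≤1 : ∀ i → ∣ (K · 𝟏) i ∣ ℕ.≤ 1
  ∣rowSum-alternating∣≤1 i = begin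
    ∣ (K · 𝟏) i ∣                              ≡⟨ cong ∣_∣ (rowSum-alternating i) ⟩
    ∣ ε i * (∑ (allFin n) ε - 1ℤ) ∣            ≡⟨ ℤ.abs-* (ε i) (∑ (allFin n) ε - 1ℤ) ⟩
    ∣ ε i ∣ ℕ.* ∣ ∑ (allFin n) ε - 1ℤ ∣        ≤⟨ ℕ.*-mono-≤ (∣sign∣≤1 (even i)) (∣S-1∣≤1 (∑-ε n)) ⟩
    1                                          ∎
    where
    open ℕ.≤-Reasoning
    ∣S-1∣≤1 : ∀ {S} → S ≡ 0ℤ ⊎ S ≡ 1ℤ → ∣ S - 1ℤ ∣ ℕ.≤ 1
    ∣S-1∣≤1 (inj₁ refl) = ℕ.≤-refl
    ∣S-1∣≤1 (inj₂ refl) = ℕ.z≤n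

-- Falling factorials

k!*nCk≡nP′k : ∀ {n k} → k ℕ.≤ n → k ! ℕ.* (n Combinatorics.C k) ≡ n P′ k
k!*nCk≡nP′k {n} {k} k≤n = begin
  k ! ℕ.* (n Combinatorics.C k)              ≡⟨ cong (k ! ℕ.*_) (nCk≡nPk/k! k≤n) ⟩
  k ! ℕ.* ((n Combinatorics.P k) ℕ./ k !)    ≡⟨ cong (λ m → k ! ℕ.* (m ℕ./ k !)) nPk≡nP′k ⟩
  k ! ℕ.* ((n P′ k) ℕ./ k !)                 ≡⟨ ℕ.m*[n/m]≡n (k!∣nP′k k≤n) ⟩
  n P′ k                                     ∎
  where
  open ≡-Reasoning
  instance
    k!≢0 : ℕ.NonZero (k !)
    k!≢0 = k ℕ.!≢0
  nPk≡nP′k : n Combinatorics.P k ≡ n P′ k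
  nPk≡nP′k = cong (λ b → if b then n P′ k else 0) (Equivalence.to T-≡ (ℕ.≤⇒≤ᵇ k≤n))

nP′k≤n^k : ∀ n k → n P′ k ℕ.≤ n ℕ.^ k
nP′k≤n^k n zero    = ℕ.≤-refl
nP′k≤n^k n (suc k) = ℕ.*-mono-≤ (ℕ.m∸n≤m n k) (nP′k≤n^k n k)

n^k≤nP′k+O[n^[k-1]] : ∀ n k → n ℕ.^ suc k ℕ.≤ n P′ suc k ℕ.+ triangular (suc k) ℕ.* n ℕ.^ k
n^k≤nP′k+O[n^[k-1]] n zero    = ℕ.≤-reflexive (sym (ℕ.+-identityʳ (n ℕ.* 1)))
n^k≤nP′k+O[n^[k-1]] n (suc k) = begin
  n ℕ.* q
    ≤⟨ ℕ.*-monoʳ-≤ n (n^k≤nP′k+O[n^[k-1]] n k) ⟩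
  n ℕ.* (p ℕ.+ t ℕ.* n ℕ.^ k)
    ≡⟨ distrib n p t (n ℕ.^ k) ⟩
  n ℕ.* p ℕ.+ t ℕ.* q
    ≤⟨ ℕ.+-monoˡ-≤ (t ℕ.* q) (ℕ.*-monoˡ-≤ p (ℕ.m≤n+m∸n n (suc k))) ⟩
  (suc k ℕ.+ (n ℕ.∸ suc k)) ℕ.* p ℕ.+ t ℕ.* q
    ≡⟨ regroup (suc k) (n ℕ.∸ suc k) p (t ℕ.* q) ⟩
  n P′ suc (suc k) ℕ.+ (suc k ℕ.* p ℕ.+ t ℕ.* q)
    ≤⟨ ℕ.+-monoʳ-≤ (n P′ suc (suc k)) (ℕ.+-monoˡ-≤ (t ℕ.* q) (ℕ.*-monoʳ-≤ (suc k) (nP′k≤n^k n (suc k)))) ⟩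
  n P′ suc (suc k) ℕ.+ (suc k ℕ.* q ℕ.+ t ℕ.* q)
    ≡⟨ cong (n P′ suc (suc k) ℕ.+_) (ℕ.*-distribʳ-+ q (suc k) t) ⟨
  n P′ suc (suc k) ℕ.+ triangular (suc (suc k)) ℕ.* q ∎
  where
  open ℕ.≤-Reasoning
  p q t : ℕ
  p = n P′ suc k
  q = n ℕ.^ suc k
  t = triangular (suc k)
  distrib : ∀ n p t q → n ℕ.* (p ℕ.+ t ℕ.* q) ≡ n ℕ.* p ℕ.+ t ℕ.* (n ℕ.* q)
  distrib = ℕ-Ring.solve-∀
  regroup : ∀ k m p r → (k ℕ.+ m) ℕ.* p ℕ.+ r ≡ m ℕ.* p ℕ.+ (k ℕ.* p ℕ.+ r)
  regroup = ℕ-Ring.solve-∀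

c*n^j<nP′[1+j] : ∀ c j {n} → triangular (suc j) ℕ.+ c ℕ.< n → c ℕ.* n ℕ.^ j ℕ.< n P′ suc j
c*n^j<nP′[1+j] c j {n} t+c<n = ℕ.+-cancelʳ-< (t ℕ.* n ℕ.^ j) _ _ (begin-strict
  c ℕ.* n ℕ.^ j ℕ.+ t ℕ.* n ℕ.^ j       ≡⟨ ℕ.+-comm (c ℕ.* n ℕ.^ j) (t ℕ.* n ℕ.^ j) ⟩
  t ℕ.* n ℕ.^ j ℕ.+ c ℕ.* n ℕ.^ j       ≡⟨ ℕ.*-distribʳ-+ (n ℕ.^ j) t c ⟨
  (t ℕ.+ c) ℕ.* n ℕ.^ j                 <⟨ ℕ.*-monoˡ-< (n ℕ.^ j) t+c<n ⟩
  n ℕ.^ suc j                           ≤⟨ n^k≤nP′k+O[n^[k-1]] n j ⟩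
  n P′ suc j ℕ.+ t ℕ.* n ℕ.^ j          ∎)
  where
  open ℕ.≤-Reasoning
  t : ℕ
  t = triangular (suc j)
  instance
    n^j≢0 : ℕ.NonZero (n ℕ.^ j)
    n^j≢0 = ℕ.m^n≢0 n j {{ℕ.>-nonZero (ℕ.≤-<-trans ℕ.z≤n t+c<n)}}

-- Limits

toℚᵘ-/ : ∀ i n .{{_ : ℕ.NonZero n}} → toℚᵘ (i / n) ℚᵘ.≃ i ℚᵘ./ n
toℚᵘ-/ i (suc n) = ℚ.toℚᵘ-fromℚᵘ (mkℚᵘ i n)

toℚᵘ-homo-∣p-q*r∣ : ∀ p q r → toℚᵘ ℚ.∣ p ℚ.- q ℚ.* r ∣ ℚᵘ.≃ ℚᵘ.∣ toℚᵘ p ℚᵘ.- toℚᵘ q ℚᵘ.* toℚᵘ r ∣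
toℚᵘ-homo-∣p-q*r∣ p q r = begin
  toℚᵘ ℚ.∣ p ℚ.- q ℚ.* r ∣
    ≈⟨ ℚ.toℚᵘ-homo-∣-∣ (p ℚ.- q ℚ.* r) ⟩
  ℚᵘ.∣ toℚᵘ (p ℚ.- q ℚ.* r) ∣
    ≈⟨ ℚᵘ.∣-∣-cong (ℚ.toℚᵘ-homo-+ p (ℚ.- (q ℚ.* r))) ⟩
  ℚᵘ.∣ toℚᵘ p ℚᵘ.+ toℚᵘ (ℚ.- (q ℚ.* r)) ∣
    ≈⟨ ℚᵘ.∣-∣-cong (ℚᵘ.+-congʳ (toℚᵘ p) (ℚ.toℚᵘ-homo‿- (q ℚ.* r))) ⟩
  ℚᵘ.∣ toℚᵘ p ℚᵘ.- toℚᵘ (q ℚ.* r) ∣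
    ≈⟨ ℚᵘ.∣-∣-cong (ℚᵘ.+-congʳ (toℚᵘ p) (ℚᵘ.-‿cong (ℚ.toℚᵘ-homo-* q r))) ⟩
  ℚᵘ.∣ toℚᵘ p ℚᵘ.- toℚᵘ q ℚᵘ.* toℚᵘ r ∣ ∎
  where open ℚᵘ.≃-Reasoning

∣c-p/q*K/M∣ᵘ<ε*K/M : ∀ c p q K M .{{_ : ℕ.NonZero q}} .{{_ : ℕ.NonZero M}} (ε : ℚᵘ) → ℚᵘ.0ℚᵘ ℚᵘ.< ε →
  ℚᵘ.↧ₙ ε ℕ.* ∣ + (q ℕ.* M ℕ.* c) - + (p ℕ.* K) ∣ ℕ.< q ℕ.* K →
  ℚᵘ.∣ + c ℚᵘ./ 1 ℚᵘ.- (+ p ℚᵘ./ q) ℚᵘ.* (+ K ℚᵘ./ M) ∣ ℚᵘ.< ε ℚᵘ.* (+ K ℚᵘ./ M)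
∣c-p/q*K/M∣ᵘ<ε*K/M c p q         K M         (mkℚᵘ (+ zero) _)  (ℚᵘ.*<* (ℤ.+<+ ())) _
∣c-p/q*K/M∣ᵘ<ε*K/M c p q         K M         (mkℚᵘ -[1+ _ ] _)  (ℚᵘ.*<* ())         _
∣c-p/q*K/M∣ᵘ<ε*K/M c p q@(suc _) K M@(suc _) (mkℚᵘ (+ suc e) d-1) _                 d*∣x∣<q*K = ℚᵘ.*<* (begin-strict
  + ∣ + c * (+ q * + M) + - (+ p * + K) * 1ℤ ∣ * (+ d * + M)
    ≡⟨ trans (cong (λ y → + ∣ y ∣ * (+ d * + M)) numerator) (regroupˡ (+ ∣ x ∣) (+ d) (+ M)) ⟩
  + d * + ∣ x ∣ * + M
    ≡⟨ cong (_* + M) (ℤ.pos-* d ∣ x ∣) ⟨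
  + (d ℕ.* ∣ x ∣) * + M
    <⟨ ℤ.*-monoʳ-<-pos (+ M) (ℤ.+<+ (ℕ.<-≤-trans d*∣x∣<q*K (ℕ.m≤m+n (q ℕ.* K) (e ℕ.* (q ℕ.* K))))) ⟩
  + (suc e ℕ.* (q ℕ.* K)) * + M
    ≡⟨ cong (_* + M) (trans (ℤ.pos-* (suc e) (q ℕ.* K)) (cong (+ suc e *_) (ℤ.pos-* q K))) ⟩
  + suc e * (+ q * + K) * + M
    ≡⟨ regroupʳ (+ suc e) (+ q) (+ K) (+ M) ⟩
  + suc e * + K * (1ℤ * (+ q * + M)) ∎)
  where
  open ℤ.≤-Reasoning
  d : ℕ
  d = suc d-1
  x : ℤ
  x = + (q ℕ.* M ℕ.* c) - + (p ℕ.* K)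
  numerator : + c * (+ q * + M) + - (+ p * + K) * 1ℤ ≡ x
  numerator = trans (regroup (+ c) (+ q) (+ M) (+ p * + K))
    (sym (cong₂ _-_ (trans (ℤ.pos-* (q ℕ.* M) c) (cong (_* + c) (ℤ.pos-* q M))) (ℤ.pos-* p K)))
    where
    regroup : ∀ c q m b → c * (q * m) + - b * 1ℤ ≡ q * m * c - b
    regroup = solve-∀
  regroupˡ : ∀ x d m → x * (d * m) ≡ d * x * m
  regroupˡ = solve-∀
  regroupʳ : ∀ e q k m → e * (q * k) * m ≡ e * k * (1ℤ * (q * m))
  regroupʳ = solve-∀

∣c-p/q*K/M∣<ε*K/M : ∀ c p q K M .{{_ : ℕ.NonZero q}} .{{_ : ℕ.NonZero M}} (ε : ℚ) → 0ℚ ℚ.< ε →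
  ℚ.↧ₙ ε ℕ.* ∣ + (q ℕ.* M ℕ.* c) - + (p ℕ.* K) ∣ ℕ.< q ℕ.* K →
  ℚ.∣ + c / 1 ℚ.- (+ p / q) ℚ.* (+ K / M) ∣ ℚ.< ε ℚ.* (+ K / M)
∣c-p/q*K/M∣<ε*K/M c p q K M ε@(mkℚ _ _ _) 0<ε d*∣x∣<q*K = ℚ.toℚᵘ-cancel-< (begin-strict
  toℚᵘ ℚ.∣ + c / 1 ℚ.- (+ p / q) ℚ.* (+ K / M) ∣
    ≃⟨ toℚᵘ-homo-∣p-q*r∣ (+ c / 1) (+ p / q) (+ K / M) ⟩
  ℚᵘ.∣ toℚᵘ (+ c / 1) ℚᵘ.- toℚᵘ (+ p / q) ℚᵘ.* toℚᵘ (+ K / M) ∣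
    ≃⟨ ℚᵘ.∣-∣-cong (ℚᵘ.+-cong (toℚᵘ-/ (+ c) 1) (ℚᵘ.-‿cong (ℚᵘ.*-cong (toℚᵘ-/ (+ p) q) (toℚᵘ-/ (+ K) M)))) ⟩
  ℚᵘ.∣ + c ℚᵘ./ 1 ℚᵘ.- (+ p ℚᵘ./ q) ℚᵘ.* (+ K ℚᵘ./ M) ∣
    <⟨ ∣c-p/q*K/M∣ᵘ<ε*K/M c p q K M (toℚᵘ ε) (ℚ.toℚᵘ-mono-< 0<ε) d*∣x∣<q*K ⟩
  toℚᵘ ε ℚᵘ.* (+ K ℚᵘ./ M)
    ≃⟨ ℚᵘ.*-congˡ {toℚᵘ ε} (toℚᵘ-/ (+ K) M) ⟨
  toℚᵘ ε ℚᵘ.* toℚᵘ (+ K / M)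
    ≃⟨ ℚ.toℚᵘ-homo-* ε (+ K / M) ⟨
  toℚᵘ (ε ℚ.* (+ K / M)) ∎)
  where open ℚᵘ.≤-Reasoning

scaled-deviation : ∀ q M c p K ℓ →
  + q * (+ M * + (c ℕ.* ℓ)) - + p * + (ℓ ℕ.* K) ≡ + ℓ * (+ (q ℕ.* M ℕ.* c) - + (p ℕ.* K))
scaled-deviation q M c p K ℓ = begin
  + q * (+ M * + (c ℕ.* ℓ)) - + p * + (ℓ ℕ.* K)
    ≡⟨ cong₂ (λ u v → + q * (+ M * u) - + p * v) (ℤ.pos-* c ℓ) (ℤ.pos-* ℓ K) ⟩
  + q * (+ M * (+ c * + ℓ)) - + p * (+ ℓ * + K)
    ≡⟨ regroup (+ q) (+ M) (+ c) (+ ℓ) (+ p) (+ K) ⟩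
  + ℓ * (+ q * + M * + c - + p * + K)
    ≡⟨ cong₂ (λ u v → + ℓ * (u - v)) (trans (ℤ.pos-* (q ℕ.* M) c) (cong (_* + c) (ℤ.pos-* q M))) (ℤ.pos-* p K) ⟨
  + ℓ * (+ (q ℕ.* M ℕ.* c) - + (p ℕ.* K)) ∎
  where
  open ≡-Reasoning
  regroup : ∀ q m c l p k → q * (m * (c * l)) - p * (l * k) ≡ l * (q * m * c - p * k)
  regroup = solve-∀

AtLeast : ℕ → Set
AtLeast ℓ = ∃ (ℓ ℕ.≤_)

module _ (j p q : ℕ) .{{_ : ℕ.NonZero q}} where

  private
    ℓ 2^ℓ : ℕ
    ℓ = suc j
    2^ℓ = 2 ℕ.^ ℓ

    size : AtLeast ℓ → ℕ
    size = proj₁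

    instance
      2^ℓ≢0 : ℕ.NonZero 2^ℓ
      2^ℓ≢0 = ℕ.m^n≢0 2 ℓ

  open Asymptotics size j

  ∣m-p/q*R∣<ε*R : ∀ m E {n} (ε : ℚ) → 0ℚ ℚ.< ε → ℓ ℕ.≤ n → triangular ℓ ℕ.+ ℚ.↧ₙ ε ℕ.* E ℕ.< n →
    ∣ + q * (+ 2^ℓ * + (m ℕ.* ℓ)) - + p * + (n P′ ℓ) ∣ ℕ.≤ E ℕ.* n ℕ.^ j →
    ℚ.∣ + m / 1 ℚ.- (+ p / q) ℚ.* R n ℓ ∣ ℚ.< ε ℚ.* R n ℓ
  ∣m-p/q*R∣<ε*R m E {n} ε 0<ε ℓ≤n large deviation≤ =
    ∣c-p/q*K/M∣<ε*K/M m p q K 2^ℓ ε 0<ε (ℕ.*-cancelˡ-< ℓ _ _ (begin-strict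
      ℓ ℕ.* (d ℕ.* ∣ x ∣)                  ≡⟨ exchange ℓ d ∣ x ∣ ⟩
      d ℕ.* (ℓ ℕ.* ∣ x ∣)                  ≡⟨ cong (d ℕ.*_) (ℤ.abs-* (+ ℓ) x) ⟨
      d ℕ.* ∣ + ℓ * x ∣                    ≡⟨ cong (λ y → d ℕ.* ∣ y ∣) (scaled-deviation q 2^ℓ m p K ℓ) ⟨
      d ℕ.* ∣ y - + p * + (ℓ ℕ.* K) ∣      ≡⟨ cong (λ k → d ℕ.* ∣ y - + p * + k ∣) ℓ*K≡nP′ℓ ⟩
      d ℕ.* ∣ y - + p * + (n P′ ℓ) ∣       ≤⟨ ℕ.*-monoʳ-≤ d deviation≤ ⟩
      d ℕ.* (E ℕ.* n ℕ.^ j)                ≡⟨ ℕ.*-assoc d E (n ℕ.^ j) ⟨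
      d ℕ.* E ℕ.* n ℕ.^ j                  <⟨ c*n^j<nP′[1+j] (d ℕ.* E) j large ⟩
      n P′ ℓ                               ≡⟨ ℓ*K≡nP′ℓ ⟨
      ℓ ℕ.* K                              ≤⟨ ℕ.*-monoʳ-≤ ℓ (ℕ.m≤n*m K q) ⟩
      ℓ ℕ.* (q ℕ.* K)                      ∎))
    where
    open ℕ.≤-Reasoning
    d K : ℕ
    d = ℚ.↧ₙ ε
    K = j ! ℕ.* (n Combinatorics.C ℓ)
    x y : ℤ
    x = + (q ℕ.* 2^ℓ ℕ.* m) - + (p ℕ.* K)
    y = + q * (+ 2^ℓ * + (m ℕ.* ℓ))
    ℓ*K≡nP′ℓ : ℓ ℕ.* K ≡ n P′ ℓ
    ℓ*K≡nP′ℓ = trans (sym (ℕ.*-assoc ℓ (j !) (n Combinatorics.C ℓ))) (k!*nCk≡nP′k ℓ≤n)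
    exchange : ∀ l d x → l ℕ.* (d ℕ.* x) ≡ d ℕ.* (l ℕ.* x)
    exchange = ℕ-Ring.solve-∀

  nP′ℓ≲n^ℓ : (λ i → + (size i P′ ℓ)) ≲ (λ i → (+ size i) ^ ℓ)
  nP′ℓ≲n^ℓ = ≤⇒≲ λ (n , _) → subst (+ (n P′ ℓ) ≤_) (pos-^ n ℓ) (ℤ.+≤+ (nP′k≤n^k n ℓ))

  n^ℓ≲nP′ℓ : (λ i → (+ size i) ^ ℓ) ≲ (λ i → + (size i P′ ℓ))
  n^ℓ≲nP′ℓ = triangular ℓ , λ (n , _) → begin
    (+ n) ^ ℓ                                             ≡⟨ pos-^ n ℓ ⟨
    + (n ℕ.^ ℓ)                                           ≤⟨ ℤ.+≤+ (n^k≤nP′k+O[n^[k-1]] n j) ⟩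
    + (n P′ ℓ) + + (triangular ℓ ℕ.* n ℕ.^ j)             ≡⟨ cong (λ s → + (n P′ ℓ) + s) (pos-*-^ (triangular ℓ) n j) ⟩
    + (n P′ ℓ) + + triangular ℓ * (+ n) ^ j               ∎
    where open ℤ.≤-Reasoning

  module _ {C : ℕ → ℕ} (isMax : ∀ n → ℓ ℕ.≤ n → IsMaxCycles n ℓ (C n)) where

    maximalTournament : ∀ i → Tournament (size i)
    maximalTournament (n , ℓ≤n) = proj₁ (proj₁ (isMax n ℓ≤n))

    C*ℓ≲cycleSeqs : (λ i → + (C (size i) ℕ.* ℓ)) ≲ (λ i → + cycleSeqs (maximalTournament i) ℓ)
    C*ℓ≲cycleSeqs = ≤⇒≲ λ i@(n , ℓ≤n) → let s = cycleSeqs (maximalTournament i) ℓ in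
      ℤ.+≤+ (subst (λ m → m ℕ.* ℓ ℕ.≤ s) (proj₂ (proj₁ (isMax n ℓ≤n))) (ℕ.m/n*n≤m s ℓ))

    cycleSeqs≲C*ℓ : (T : ∀ i → Tournament (size i)) → (λ i → + cycleSeqs (T i) ℓ) ≲ (λ i → + (C (size i) ℕ.* ℓ))
    cycleSeqs≲C*ℓ T = ℓ , λ i@(n , ℓ≤n) →
      let open ℤ.≤-Reasoning
          s = cycleSeqs (T i) ℓ
          instance
            n^j≢0 : ℕ.NonZero (n ℕ.^ j)
            n^j≢0 = ℕ.m^n≢0 n j {{ℕ.>-nonZero (ℕ.<-≤-trans ℕ.z<s ℓ≤n)}}
      in begin
      + s                                         ≡⟨ cong +_ (ℕ.m≡m%n+[m/n]*n s ℓ) ⟩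
      + (s ℕ.% ℓ ℕ.+ numCycles (T i) ℓ ℕ.* ℓ)     ≤⟨ ℤ.+≤+ (ℕ.+-mono-≤ (ℕ.<⇒≤ (ℕ.m%n<n s ℓ))
                                                       (ℕ.*-monoˡ-≤ ℓ (proj₂ (isMax n ℓ≤n) (T i)))) ⟩
      + (ℓ ℕ.+ C n ℕ.* ℓ)                         ≤⟨ ℤ.+≤+ (ℕ.+-monoˡ-≤ (C n ℕ.* ℓ) (ℕ.m≤m*n ℓ (n ℕ.^ j))) ⟩
      + (ℓ ℕ.* n ℕ.^ j) + + (C n ℕ.* ℓ)           ≡⟨ ℤ.+-comm (+ (ℓ ℕ.* n ℕ.^ j)) (+ (C n ℕ.* ℓ)) ⟩
      + (C n ℕ.* ℓ) + + (ℓ ℕ.* n ℕ.^ j)           ≡⟨ cong (λ m → + (C n ℕ.* ℓ) + m) (pos-*-^ ℓ n j) ⟩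
      + (C n ℕ.* ℓ) + + ℓ * (+ n) ^ j             ∎

  ≲⇒LimitIs :
    (∀ (T : ∀ i → Tournament (size i)) → (λ i → + q * (+ 2^ℓ * + cycleSeqs (T i) ℓ)) ≲ (λ i → + p * (+ size i) ^ ℓ)) →
    (∃ λ (T : ∀ i → Tournament (size i)) → (λ i → + p * (+ size i) ^ ℓ) ≲ (λ i → + q * (+ 2^ℓ * + cycleSeqs (T i) ℓ))) →
    LimitIs ℓ (+ p / q)
  ≲⇒LimitIs upper (T , lower) C isMax ε 0<ε =
    let E , deviation≤ = ≲-antisym C≲P′ P′≲C
        N = triangular ℓ ℕ.+ ℚ.↧ₙ ε ℕ.* E
    in ℓ ℕ.+ suc N , λ n ℓ+N<n → let ℓ≤n = ℕ.m+n≤o⇒m≤o ℓ ℓ+N<n in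
       ∣m-p/q*R∣<ε*R (C n) E ε 0<ε ℓ≤n (ℕ.m+n≤o⇒n≤o ℓ ℓ+N<n) (deviation≤ (n , ℓ≤n))
    where
    open ≲-Reasoning
    C≲P′ : (λ i → + q * (+ 2^ℓ * + (C (size i) ℕ.* ℓ))) ≲ (λ i → + p * + (size i P′ ℓ))
    C≲P′ = begin
      (λ i → + q * (+ 2^ℓ * + (C (size i) ℕ.* ℓ)))
        ≲⟨ *-monoˡ-≲ q (*-monoˡ-≲ 2^ℓ (C*ℓ≲cycleSeqs isMax)) ⟩
      (λ i → + q * (+ 2^ℓ * + cycleSeqs (maximalTournament isMax i) ℓ))
        ≲⟨ upper (maximalTournament isMax) ⟩
      (λ i → + p * (+ size i) ^ ℓ)
        ≲⟨ *-monoˡ-≲ p n^ℓ≲nP′ℓ ⟩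
      (λ i → + p * + (size i P′ ℓ)) ∎
    P′≲C : (λ i → + p * + (size i P′ ℓ)) ≲ (λ i → + q * (+ 2^ℓ * + (C (size i) ℕ.* ℓ)))
    P′≲C = begin
      (λ i → + p * + (size i P′ ℓ))                      ≲⟨ *-monoˡ-≲ p nP′ℓ≲n^ℓ ⟩
      (λ i → + p * (+ size i) ^ ℓ)                       ≲⟨ lower ⟩
      (λ i → + q * (+ 2^ℓ * + cycleSeqs (T i) ℓ))        ≲⟨ *-monoˡ-≲ q (*-monoˡ-≲ 2^ℓ (cycleSeqs≲C*ℓ isMax T)) ⟩
      (λ i → + q * (+ 2^ℓ * + (C (size i) ℕ.* ℓ)))       ∎

excess⇒LimitIs : ∀ j B e .{{_ : ℕ.NonZero j}} .{{_ : ℕ.NonZero (j !)}} →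
  minSignedPaths j (chords j) ≡ - + B → minSignedPaths j [] ≡ - + B →
  (∀ {n} (K : Matrix n) → Skew K → excess (moment K) j ≤ (+ n) ^ suc j) →
  (∀ {n} (K : Matrix n) → Skew K → (∀ x y → ∣ K x y ∣ ℕ.≤ 1) → (∀ x → ∣ (K · 𝟏) x ∣ ℕ.≤ 1) →
    (+ n) ^ suc j ≤ excess (moment K) j + + e * (+ n) ^ j) →
  LimitIs (suc j) (+ (j ! ℕ.+ B) / j !)
excess⇒LimitIs j@(suc k) B e min≡-B transitive≡-B excess-≤ excess-≥ =
  ≲⇒LimitIs j (j ! ℕ.+ B) (j !)
    (λ T → cycleSeqs-≲ T k B min≡-B (≤⇒≲ λ i → excess-≤ (signMatrix (T i)) (signMatrix-skew (T i))))
    (alternating , cycleSeqs-≳ alternating k B transitive≡-B (λ _ → switched-alternating-trans) n^ℓ≲excess)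
  where
  open Asymptotics {AtLeast (suc j)} proj₁ j
  alternating : ∀ (i : AtLeast (suc j)) → Tournament (proj₁ i)
  alternating (n , _) = alternatingTournament n
  n^ℓ≲excess : (λ (n , _) → (+ n) ^ suc j) ≲ (λ i → excess (moment (signMatrix (alternating i))) j)
  n^ℓ≲excess = e , λ (n , _) → let T = alternatingTournament n in
    excess-≥ (signMatrix T) (signMatrix-skew T) (∣signMatrix∣≤1 T) (∣rowSum-alternating∣≤1 n)

minSignedPaths₃ : minSignedPaths 3 (chords 3) ≡ - + 2
minSignedPaths₃ = refl

minSignedPaths₇ : minSignedPaths 7 (chords 7) ≡ - + 272
minSignedPaths₇ = refl

theorem20 : LimitIs 4 ((+ 4) / 3) × LimitIs 8 ((+ 332) / 315)
theorem20 =
  excess⇒LimitIs 3 2 4 minSignedPaths₃ refl excess-moment₄-≤ excess-moment₄-≥ ,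
  excess⇒LimitIs 7 272 24 minSignedPaths₇ refl excess-moment₈-≤ excess-moment₈-≥
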